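{- Let $n\ge1$ and $\mathbf{k}=(k_1\le k_2\le\cdots\le k_n)\in\mathbb{Z}^n$. The number $\alpha(n;\mathbf{k})$ of monotone triangles with bottom row $\mathbf{k}$ is given by \[ \alpha(n;\mathbf{k})=\sum_{G\in\mathcal{Q}_{\mathrm{ess}}}(-1)^{|I(G)|}\,\Omega_{\mathrm{GT}_n/G,A/G}(\mathbf{k}), \] and thus is a polynomial (there is a polynomial in $k_1,\dots,k_n$ agreeing with $\alpha(n;\mathbf{k})$ for all such $\mathbf{k}$). In particular $\alpha(n;\mathbf{k})=0$ whenever $k_j=k_{j+1}=k_{j+2}$ for some $j$.
   Context: A monotone triangle with bottom row $\mathbf{k}$ is an integer array $(a_{i,j})_{1\le j\le i\le n}$ with $a_{n,j}=k_j$, $a_{i,j}\le a_{i-1,j}$ ($1\le j<i\le n$), $a_{i,j}\le a_{i+1,j+1}$ ($1\le j\le i<n$), and $a_{i,j}<a_{i,j+1}$ ($1\le j<i<n$). $\mathrm{GT}_n$ is the poset on $\{(i,j):1\le j\le i\le n\}$ with $(i,j)\preceq(k,l)$ iff $k-i\le l-j$ and $j\le l$; $A=\{(n,1),\dots,(n,n)\}$ and $\mathbf{k}$ is viewed as the map $(n,j)\mapsto k_j$. $\mathrm{bad}_n=\{(i,j):1\le j<i<n\}$. For $(i,j)\in\mathrm{bad}_n$ the diamond $G_{ij}$ is the set of cover relations $(i,j)\prec(i-1,j)$, $(i,j)\prec(i+1,j+1)$, $(i-1,j)\prec(i,j+1)$, $(i+1,j+1)\prec(i,j+1)$. A diamond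 poset $G$ is a (possibly empty) union of diamonds; $I(G)=\{(i,j)\in\mathrm{bad}_n:G_{ij}\subseteq G\}$; $G$ is closed if $G_{i,j}\cup G_{i,j+1}\subseteq G$ implies $G_{i-1,j}\cup G_{i+1,j+1}\subseteq G$. $\mathcal{Q}_{\mathrm{ess}}$ is the set of closed diamond posets $G$ with no $(i,j)$ such that both $(i,j),(i,j+1)\in I(G)$. $\mathrm{GT}_n/G$ is the quotient poset obtained by contracting the cover relations of $G$ (elements: connected components of $G$), $A/G$ the image of $A$, and $\Omega_{\mathrm{GT}_n/G,A/G}(\mathbf{k})$ is the number of integer-valued order preserving maps on $\mathrm{GT}_n/G$ extending the map induced by $\mathbf{k}$ on $A/G$; equivalently, the number of order preserving $a:\mathrm{GT}_n\to\mathbb{Z}$ with $a(n,j)=k_j$ for all $j$ and $a(p)=a(q)$ for every cover relation $p\prec q$ in $G$. -}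

module Defs where

open import Data.Nat as ℕ using (ℕ; zero; suc; _∸_; z≤n; s≤s)
import Data.Nat.Properties as ℕP
open import Data.Integer as ℤ using (ℤ; +_)
open import Data.Rational as ℚ using (ℚ)
open import Data.Fin as Fin using (Fin; toℕ)
open import Data.Vec using (Vec; lookup)
open import Data.List using (List; []; _∷_; map; concatMap; upTo; length; filter; foldr)
open import Data.List.Relation.Unary.All using (All; all?)
open import Data.List.Relation.Unary.Any using (Any; any?)
open import Data.List.Relation.Unary.AllPairs using (AllPairs)
open import Data.List.Membership.Propositional using (_∈_)
open import Data.List.Membership.DecPropositional as DecMem using ()
open import Data.Product using (Σ; _×_; _,_)
open import Data.Product.Properties using (≡-dec)
open import Relation.Nullary using (¬_; Dec)
open import Relation.Nullary.Decidable using (_×-dec_; _→-dec_; ¬?)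
open import Relation.Binary.PropositionalEquality using (_≡_)

-- Arrays.  An array is a map a : ℕ → ℕ → ℤ, a i j = a_{i,j}; only the
-- values at positions of GT_n, i.e. 1 ≤ j ≤ i ≤ n, are relevant.

Arr : Set
Arr = ℕ → ℕ → ℤ

Valid : ℕ → ℕ → ℕ → Set
Valid n i j = (1 ℕ.≤ j) × (j ℕ.≤ i) × (i ℕ.≤ n)

_≈[_]_ : Arr → ℕ → Arr → Set
a ≈[ n ] b = ∀ i j → Valid n i j → a i j ≡ b i j

-- The bottom row of a is k (positions (n,1),…,(n,n) ↦ k_1,…,k_n).
-- k is 0-indexed as a Vec: k_j = lookup k (j-1).
BottomRow : (n : ℕ) → Vec ℤ n → Arr → Set
BottomRow n k a = (j : Fin n) → a n (suc (toℕ j)) ≡ lookup k j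

WeaklyIncreasing : {n : ℕ} → Vec ℤ n → Set
WeaklyIncreasing {n} k = (j l : Fin n) → j Fin.≤ l → lookup k j ℤ.≤ lookup k l

MonotoneTriangle : (n : ℕ) → Vec ℤ n → Arr → Set
MonotoneTriangle n k a =
    BottomRow n k a
  × (∀ i j → 1 ℕ.≤ j → j ℕ.< i → i ℕ.≤ n → a i j ℤ.≤ a (i ∸ 1) j)
  × (∀ i j → 1 ℕ.≤ j → j ℕ.≤ i → i ℕ.< n → a i j ℤ.≤ a (suc i) (suc j))
  × (∀ i j → 1 ℕ.≤ j → j ℕ.< i → i ℕ.< n → a i j ℤ.< a i (suc j))

_⪯GT_ : ℕ × ℕ → ℕ × ℕ → Set
(i , j) ⪯GT (k , l) = ((+ k) ℤ.- (+ i) ℤ.≤ (+ l) ℤ.- (+ j)) × (j ℕ.≤ l)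

OrderPreserving : ℕ → Arr → Set
OrderPreserving n a =
  ∀ i j k l → Valid n i j → Valid n k l → (i , j) ⪯GT (k , l) → a i j ℤ.≤ a k l

-- Finite cardinality of a set of arrays, with arrays identified when
-- they agree on GT_n:  Count n P m  means  |{a : GT_n → ℤ | P a}| = m.

record Count (n : ℕ) (P : Arr → Set) (m : ℕ) : Set where
  field
    elems    : List Arr
    size     : length elems ≡ m
    sound    : All P elems
    complete : ∀ a → P a → Any (λ b → a ≈[ n ] b) elems
    distinct : AllPairs (λ a b → ¬ (a ≈[ n ] b)) elems

Pt : Set
Pt = ℕ × ℕ

Edge : Set
Edge = Pt × Pt

range : ℕ → ℕ → List ℕ
range a b = map (a ℕ.+_) (upTo (suc b ∸ a))

bad : ℕ → List Pt
bad n = concatMap (λ i → map (λ j → (i , j)) (range 1 (i ∸ 1))) (range 2 (n ∸ 1))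

-- the diamond G_{ij} as its four cover relations (p , q) meaning p ≺ q
diamond : Pt → List Edge
diamond (i , j) =
    ((i , j)         , (i ∸ 1 , j))
  ∷ ((i , j)         , (suc i , suc j))
  ∷ ((i ∸ 1 , j)     , (i , suc j))
  ∷ ((suc i , suc j) , (i , suc j))
  ∷ []

-- A diamond poset is encoded by a set S ⊆ bad_n of diamonds
-- (a sublist of bad n); G(S) = ⋃_{s ∈ S} G_s.  Edge membership:
InG : List Pt → Edge → Set
InG S e = Any (λ s → e ∈ diamond s) S

Contained : List Pt → Pt → Set
Contained S p = All (InG S) (diamond p)

InI : ℕ → List Pt → Pt → Set
InI n S p = (p ∈ bad n) × Contained S p

right : Pt → Pt
right (i , j) = (i , suc j)

-- S = I(G(S)) (S ⊆ I(G(S)) is automatic), so that S ↦ G(S) is a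
-- bijection from saturated S onto diamond posets, with inverse G ↦ I(G).
Saturated : ℕ → List Pt → Set
Saturated n S = All (λ p → Contained S p → p ∈ S) (bad n)

Closed : ℕ → List Pt → Set
Closed n S =
  All (λ p → InI n S p → InI n S (right p) →
             Contained S (Data.Product.proj₁ p ∸ 1 , Data.Product.proj₂ p)
           × Contained S (suc (Data.Product.proj₁ p) , suc (Data.Product.proj₂ p)))
      (bad n)

NoAdjacent : ℕ → List Pt → Set
NoAdjacent n S = All (λ p → ¬ (InI n S p × InI n S (right p))) (bad n)

Qess : ℕ → List Pt → Set
Qess n S = Saturated n S × Closed n S × NoAdjacent n S

sublists : {A : Set} → List A → List (List A)
sublists []       = [] ∷ []
sublists (x ∷ xs) = let r = sublists xs in Data.List._++_ (map (x ∷_) r) r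

private
  _≟P_ : (p q : Pt) → Dec (p ≡ q)
  _≟P_ = ≡-dec ℕ._≟_ ℕ._≟_
  _≟E_ : (e f : Edge) → Dec (e ≡ f)
  _≟E_ = ≡-dec _≟P_ _≟P_

InG? : ∀ S e → Dec (InG S e)
InG? S e = any? (λ s → DecMem._∈?_ _≟E_ e (diamond s)) S

Contained? : ∀ S p → Dec (Contained S p)
Contained? S p = all? (InG? S) (diamond p)

InI? : ∀ n S p → Dec (InI n S p)
InI? n S p = DecMem._∈?_ _≟P_ p (bad n) ×-dec Contained? S p

Qess? : ∀ n S → Dec (Qess n S)
Qess? n S =
     all? (λ p → Contained? S p →-dec DecMem._∈?_ _≟P_ p S) (bad n)
  ×-dec all? (λ p → InI? n S p →-dec InI? n S (right p) →-dec
               (Contained? S _ ×-dec Contained? S _)) (bad n)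
  ×-dec all? (λ p → ¬? (InI? n S p ×-dec InI? n S (right p))) (bad n)

QessList : ℕ → List (List Pt)
QessList n = filter (Qess? n) (sublists (bad n))

sign : ℕ → ℤ
sign zero          = + 1
sign (suc zero)    = ℤ.- (+ 1)
sign (suc (suc m)) = sign m

-- Ω_{GT_n/G, A/G}(k): order preserving a : GT_n → ℤ extending k on A
-- and constant along every cover relation of G = G(S).

OmegaSet : (n : ℕ) → Vec ℤ n → List Pt → Arr → Set
OmegaSet n k S a =
    OrderPreserving n a
  × BottomRow n k a
  × (∀ p q → InG S (p , q) → a (Data.Product.proj₁ p) (Data.Product.proj₂ p)
                            ≡ a (Data.Product.proj₁ q) (Data.Product.proj₂ q))

QessSum : ℕ → (List Pt → ℕ) → ℤ
QessSum n ω = foldr ℤ._+_ (+ 0) (map (λ S → sign (length S) ℤ.* (+ ω S)) (QessList n))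

data Poly (n : ℕ) : Set where
  con  : ℚ → Poly n
  var  : Fin n → Poly n
  _⊕_  : Poly n → Poly n → Poly n
  _⊗_  : Poly n → Poly n → Poly n

evalPoly : {n : ℕ} → Poly n → Vec ℤ n → ℚ
evalPoly (con c) x = c
evalPoly (var i) x = (lookup x i) ℚ./ 1
evalPoly (p ⊕ q) x = evalPoly p x ℚ.+ evalPoly q x
evalPoly (p ⊗ q) x = evalPoly p x ℚ.* evalPoly q x

{-# OPTIONS --safe #-}
-- Monotone triangles are the order preserving a : GT_n → ℤ without an equality a_{i,j} = a_{i,j+1} at a point of
-- bad_n, and such an equality collapses the whole diamond G_{ij}.  Hence the signed sum over Q_ess counts a with weight
-- ∑ (-1)^|S| over the sets S without adjacent points on which a has equalities.  If a has any equality, one in the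
-- topmost possible row has no neighbouring equality (two adjacent ones force one in the row above), and adding it to or
-- removing it from S is a sign reversing involution, so the weight is 0.
--
-- For polynomiality, α(n;k) is the sum of α(n-1;l) over the strictly increasing l interlacing k.  As α(n-1;l) vanishes
-- when l_j = l_{j+1} = l_{j+2}, the strictness can be traded for a signed sum over boxes:
--   D(k_1,k_2,k_3,…; f) = ∑_{k_1 ≤ x ≤ k_2} D(k_2,k_3,…; f(x,·)) - D(k_3,…; f(k_2,k_2,·)),
-- and summing a polynomial over an interval with polynomial ends gives a polynomial.
module Submission where

open import Defs
open import Data.Bool using (true; false; if_then_else_)
open import Data.Nat as ℕ using (ℕ; zero; suc; z≤n; s≤s; _∸_; _≤_)
import Data.Nat.Properties as ℕP
import Data.Nat.Coprimality as Coprimality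
open import Data.Integer as ℤ using (ℤ; +_; 0ℤ; 1ℤ; _+_; _*_; _-_; -_)
import Data.Integer.Properties as ℤP
open import Data.Integer.Solver using (module +-*-Solver)
open import Data.Rational as ℚ using (ℚ; mkℚ; 0ℚ; 1ℚ; 1/_; _/_)
import Data.Rational.Properties as ℚP
open import Data.Rational.Solver using () renaming (module +-*-Solver to ℚ-Solver)
open import Data.Fin using (Fin; zero; suc; toℕ; fromℕ<)
import Data.Fin.Properties as FinP
open import Data.Maybe using (Maybe; just; nothing; maybe′)
open import Data.Vec as Vec using (Vec; []; _∷_; lookup; tabulate)
import Data.Vec.Properties as VecP
open import Data.Vec.Relation.Unary.Linked as Linked using (Linked; []; [-]; _∷_; linked?)
open import Data.Vec.Relation.Binary.Pointwise.Inductive as Pointwise using (Pointwise; []; _∷_)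
import Data.Vec.Relation.Binary.Pointwise.Extensional as Ext
open import Data.List using (List; []; _∷_; _++_; map; length; filter; foldr; concatMap; applyUpTo; cartesianProductWith)
open import Data.List.Properties using (length-++; length-map)
open import Data.List.Relation.Unary.All as All using (All; []; _∷_; all?)
import Data.List.Relation.Unary.All.Properties as AllP
open import Data.List.Relation.Unary.Any as Any using (Any; here; there; any?)
import Data.List.Relation.Unary.Any.Properties as AnyP
open import Data.List.Relation.Unary.AllPairs as AllPairs using (AllPairs; []; _∷_)
import Data.List.Relation.Unary.AllPairs.Properties as AllPairsP
open import Data.List.Relation.Unary.Unique.Propositional using (Unique)
import Data.List.Relation.Unary.Unique.Propositional.Properties as UniqueP
open import Data.List.Membership.Propositional using (_∈_; find; lose)
open import Data.List.Membership.Propositional.Properties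
open import Data.Product using (∃; Σ; _×_; _,_; proj₁; proj₂)
open import Data.Product.Properties using (≡-dec)
open import Data.Sum using (_⊎_; inj₁; inj₂; [_,_]′)
open import Algebra.Properties.AbelianGroup ℤP.+-0-abelianGroup using () renaming (∙-cancelˡ to ℤ-cancelˡ)
open import Algebra.Properties.CommutativeSemigroup ℤP.+-commutativeSemigroup using (interchange; xy∙z≈xz∙y)
open import Function using (_∘_)
open import Relation.Nullary using (¬_; Dec; yes; no; does; contradiction)
open import Relation.Nullary.Decidable using (¬?; _×-dec_; _⊎-dec_; decidable-stable; dec-true; dec-false)
open import Relation.Binary.PropositionalEquality using (_≡_; _≢_; refl; sym; trans; cong; cong₂; subst; subst₂; module ≡-Reasoning)

-- Finite sums and cardinalities

∑ : {A : Set} → List A → (A → ℤ) → ℤ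
∑ xs f = foldr _+_ 0ℤ (map f xs)

infixr 8 [_]·_

-- The Iverson bracket, used as a scalar factor. Branching on `does` makes both cases reduce without
-- a multiplication.
[_]·_ : {P : Set} → Dec P → ℤ → ℤ
[ d ]· z = if does d then z else 0ℤ

module _ {P : Set} where

  []·-yes : (d : Dec P) → P → ∀ z → [ d ]· z ≡ z
  []·-yes (yes _) p z = refl
  []·-yes (no ¬p) p z = contradiction p ¬p

  []·-no : (d : Dec P) → ¬ P → ∀ z → [ d ]· z ≡ 0ℤ
  []·-no (yes p) ¬p z = contradiction p ¬p
  []·-no (no _)  ¬p z = refl

  []·-zero : (d : Dec P) → [ d ]· 0ℤ ≡ 0ℤ
  []·-zero (yes _) = refl
  []·-zero (no _)  = refl

  []·-neg : (d : Dec P) → ∀ z → [ d ]· (- z) ≡ - ([ d ]· z)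
  []·-neg (yes _) z = refl
  []·-neg (no _)  z = refl

[]·-⇔ : {P Q : Set} (d : Dec P) (e : Dec Q) → (P → Q) → (Q → P) → ∀ z → [ d ]· z ≡ [ e ]· z
[]·-⇔ (yes p) e to from z = sym ([]·-yes e (to p) z)
[]·-⇔ (no ¬p) e to from z = sym ([]·-no e (¬p ∘ from) z)

module _ {A : Set} where

  ∑-cong : ∀ xs {f g : A → ℤ} → (∀ {x} → x ∈ xs → f x ≡ g x) → ∑ xs f ≡ ∑ xs g
  ∑-cong []       eq = refl
  ∑-cong (x ∷ xs) eq = cong₂ _+_ (eq (here refl)) (∑-cong xs (eq ∘ there))

  ∑-zero : ∀ xs {f : A → ℤ} → (∀ {x} → x ∈ xs → f x ≡ 0ℤ) → ∑ xs f ≡ 0ℤ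
  ∑-zero []       eq = refl
  ∑-zero (x ∷ xs) eq = cong₂ _+_ (eq (here refl)) (∑-zero xs (eq ∘ there))

  ∑-+ : ∀ xs (f g : A → ℤ) → ∑ xs (λ x → f x + g x) ≡ ∑ xs f + ∑ xs g
  ∑-+ []       f g = refl
  ∑-+ (x ∷ xs) f g = trans (cong (λ s → f x + g x + s) (∑-+ xs f g)) (interchange (f x) (g x) _ _)

  ∑-*ˡ : ∀ c xs (f : A → ℤ) → ∑ xs (λ x → c * f x) ≡ c * ∑ xs f
  ∑-*ˡ c []       f = sym (ℤP.*-zeroʳ c)
  ∑-*ˡ c (x ∷ xs) f = trans (cong (λ s → c * f x + s) (∑-*ˡ c xs f)) (sym (ℤP.*-distribˡ-+ c (f x) _))

  ∑-++ : ∀ xs ys (f : A → ℤ) → ∑ (xs ++ ys) f ≡ ∑ xs f + ∑ ys f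
  ∑-++ []       ys f = sym (ℤP.+-identityˡ _)
  ∑-++ (x ∷ xs) ys f = trans (cong (λ s → f x + s) (∑-++ xs ys f)) (sym (ℤP.+-assoc (f x) _ _))

  ∑-filter : {P : A → Set} (P? : ∀ x → Dec (P x)) → ∀ xs (f : A → ℤ) →
             ∑ (filter P? xs) f ≡ ∑ xs (λ x → [ P? x ]· f x)
  ∑-filter P? []       f = refl
  ∑-filter P? (x ∷ xs) f with does (P? x)
  ... | true  = cong (λ s → f x + s) (∑-filter P? xs f)
  ... | false = trans (∑-filter P? xs f) (sym (ℤP.+-identityˡ _))

  length-∑ : (xs : List A) → + length xs ≡ ∑ xs (λ _ → 1ℤ)
  length-∑ []       = refl
  length-∑ (x ∷ xs) = cong (λ s → 1ℤ + s) (length-∑ xs)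

  length-filter-∑ : {P : A → Set} (P? : ∀ x → Dec (P x)) → ∀ xs →
                    + length (filter P? xs) ≡ ∑ xs (λ x → [ P? x ]· 1ℤ)
  length-filter-∑ P? xs = trans (length-∑ (filter P? xs)) (∑-filter P? xs _)

  -- As `xs` has no repetitions, the exceptional point `c` enters exactly once, so the discrepancy
  -- `C` there is the discrepancy of the sums.
  ∑-extract : ∀ {xs c C} {f g : A → ℤ} → Unique xs → c ∈ xs → (∀ {x} → x ∈ xs → x ≢ c → f x ≡ g x) →
              f c ≡ g c + C → ∑ xs f ≡ ∑ xs g + C
  ∑-extract {x ∷ xs} {C = C} {f} {g} (x∉ ∷ _) (here refl) eq eq-c = begin
    f x + ∑ xs f       ≡⟨ cong₂ _+_ eq-c (∑-cong xs λ y∈ → eq (there y∈) λ y≡x → All.lookup x∉ y∈ (sym y≡x)) ⟩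
    g x + C + ∑ xs g   ≡⟨ xy∙z≈xz∙y (g x) C (∑ xs g) ⟩
    g x + ∑ xs g + C   ∎
    where open ≡-Reasoning
  ∑-extract {x ∷ xs} {C = C} {f} {g} (x∉ ∷ u) (there c∈) eq eq-c =
    trans (cong₂ _+_ (eq (here refl) (All.lookup x∉ c∈)) (∑-extract u c∈ (eq ∘ there) eq-c))
          (sym (ℤP.+-assoc (g x) (∑ xs g) C))

∑-swap : {A B : Set} → ∀ xs ys (f : A → B → ℤ) →
         ∑ xs (λ x → ∑ ys (f x)) ≡ ∑ ys (λ y → ∑ xs (λ x → f x y))
∑-swap []       ys f = sym (∑-zero ys λ _ → refl)
∑-swap (x ∷ xs) ys f = trans (cong (λ s → ∑ ys (f x) + s) (∑-swap xs ys f)) (sym (∑-+ ys (f x) _))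

∑-map : {A B : Set} → ∀ (g : A → B) xs f → ∑ (map g xs) f ≡ ∑ xs (f ∘ g)
∑-map g []       f = refl
∑-map g (x ∷ xs) f = cong (λ s → f (g x) + s) (∑-map g xs f)

∑-× : {A B C : Set} → ∀ (g : A → B → C) xs ys f →
      ∑ (cartesianProductWith g xs ys) f ≡ ∑ xs (λ x → ∑ ys (f ∘ g x))
∑-× g []       ys f = refl
∑-× g (x ∷ xs) ys f = trans (∑-++ (map (g x) ys) _ f) (cong₂ _+_ (∑-map (g x) ys f) (∑-× g xs ys f))

-- Cardinalities of sets of arrays up to agreement on GT_n

≈-sym : ∀ n {a b} → a ≈[ n ] b → b ≈[ n ] a
≈-sym n eq i j v = sym (eq i j v)

≈-trans : ∀ n {a b c} → a ≈[ n ] b → b ≈[ n ] c → a ≈[ n ] c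
≈-trans n eq eq′ i j v = trans (eq i j v) (eq′ i j v)

module _ (n : ℕ) where

  private
    Apart : Arr → Arr → Set
    Apart a b = ¬ (a ≈[ n ] b)

    remove : ∀ {P : Arr → Set} {bs} → Any P bs → List Arr
    remove {bs = b ∷ bs} (here _)  = bs
    remove {bs = b ∷ bs} (there p) = b ∷ remove p

    length-remove : ∀ {P : Arr → Set} {bs} (p : Any P bs) → length bs ≡ suc (length (remove p))
    length-remove (here _)  = refl
    length-remove (there p) = cong suc (length-remove p)

    remove-keeps : ∀ {a c} → Apart a c → ∀ {bs} (p : Any (a ≈[ n ]_) bs) →
                   Any (c ≈[ n ]_) bs → Any (c ≈[ n ]_) (remove p)
    remove-keeps a≉c (here a≈b) (here c≈b) = contradiction (≈-trans n a≈b (≈-sym n c≈b)) a≉c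
    remove-keeps a≉c (here a≈b) (there q)  = q
    remove-keeps a≉c (there p)  (here c≈b) = here c≈b
    remove-keeps a≉c (there p)  (there q)  = there (remove-keeps a≉c p q)

  -- By transitivity of `≈`, two arrays that are apart cannot share a match in `bs`. Removing the
  -- match of the first array therefore keeps the matches of all the others.
  pigeonhole : ∀ {as bs} → AllPairs (λ a b → ¬ (a ≈[ n ] b)) as →
               All (λ a → Any (a ≈[ n ]_) bs) as → length as ℕ.≤ length bs
  pigeonhole []           _        = z≤n
  pigeonhole {bs = bs} (a# ∷ as#) (p ∷ ps) = subst (_ ℕ.≤_) (sym (length-remove p))
    (s≤s (pigeonhole as# (All.zipWith (λ (a≉c , q) → remove-keeps a≉c p q) (a# , ps))))

  Count-unique : ∀ {P m m′} → Count n P m → Count n P m′ → m ≡ m′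
  Count-unique {P} c c′ = ℕP.≤-antisym (le c c′) (le c′ c)
    where
    le : ∀ {m m′} → Count n P m → Count n P m′ → m ℕ.≤ m′
    le c c′ = subst₂ ℕ._≤_ (size c) (size c′) (pigeonhole (distinct c) (All.map (complete c′ _) (sound c)))
      where open Count

  -- `R` has to respect `≈` because completeness only yields a listed array that agrees with the
  -- given one on GT_n.
  Count-filter : ∀ {P Q R : Arr → Set} {m} (R? : ∀ a → Dec (R a)) →
                 (∀ {a b} → a ≈[ n ] b → R a → R b) →
                 (∀ {a} → P a → R a → Q a) → (∀ {a} → Q a → P a × R a) →
                 (c : Count n P m) → Count n Q (length (filter R? (Count.elems c)))
  Count-filter {R = R} R? R-resp to from c = record
    { elems    = filter R? elems
    ; size     = refl
    ; sound    = All.zipWith (λ (p , r) → to p r) (AllP.filter⁺ R? sound , AllP.all-filter R? elems)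
    ; complete = λ a q → let (p , r) = from q in keep r (complete a p)
    ; distinct = AllPairsP.filter⁺ R? distinct
    }
    where
    open Count c
    keep : ∀ {a bs} → R a → Any (a ≈[ n ]_) bs → Any (a ≈[ n ]_) (filter R? bs)
    keep {bs = b ∷ bs} r (here a≈b) with R? b
    ... | yes _  = here a≈b
    ... | no ¬rb = contradiction (R-resp a≈b r) ¬rb
    keep {bs = b ∷ bs} r (there p) with does (R? b)
    ... | true  = there (keep r p)
    ... | false = keep r p

-- Diamonds and sign cancellation

∈-range⁻ : ∀ a b {x} → x ∈ range a b → a ℕ.≤ x × x ℕ.≤ b
∈-range⁻ a b x∈ with ∈-map⁻ (a ℕ.+_) x∈
... | t , t∈ , refl = ℕP.m≤m+n a t ,
      ℕ.s≤s⁻¹ (subst (ℕ._≤ suc b) (cong suc (ℕP.+-comm t a)) (ℕP.m≤o∸n⇒m+n≤o (suc t) a≤ (∈-upTo⁻ t∈)))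
  where
  a≤ : a ℕ.≤ suc b
  -- The truncated difference `suc b ∸ a` exceeds `t`, hence is nonzero.
  a≤ = ℕP.<⇒≤ (ℕP.m∸n≢0⇒n<m λ eq → contradiction (subst (t ℕ.<_) eq (∈-upTo⁻ t∈)) λ ())

∈-range⁺ : ∀ {a b x} → a ℕ.≤ x → x ℕ.≤ b → x ∈ range a b
∈-range⁺ {a} {b} {x} a≤x x≤b = subst (_∈ range a b) (ℕP.m+[n∸m]≡n a≤x)
  (∈-map⁺ (a ℕ.+_) (∈-upTo⁺ (ℕP.∸-monoˡ-< (s≤s x≤b) a≤x)))

Bad : ℕ → Pt → Set
Bad n (i , j) = 1 ℕ.≤ j × j ℕ.< i × i ℕ.< n

∈-bad⁻ : ∀ n {p} → p ∈ bad n → Bad n p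
∈-bad⁻ n {p} p∈ with find (∈-concatMap⁻ (λ i → map (i ,_) (range 1 (i ∸ 1))) {xs = range 2 (n ∸ 1)} p∈)
... | i , i∈ , q with ∈-map⁻ (i ,_) q
... | j , j∈ , refl = aux n (∈-range⁻ 2 (n ∸ 1) i∈) (∈-range⁻ 1 (i ∸ 1) j∈)
  where
  aux : ∀ n {i j} → 2 ℕ.≤ i × i ℕ.≤ n ∸ 1 → 1 ℕ.≤ j × j ℕ.≤ i ∸ 1 → Bad n (i , j)
  aux zero    (s≤s _ , ())
  aux (suc n) (s≤s _ , i≤n) (1≤j , j≤i) = 1≤j , s≤s j≤i , s≤s i≤n

∈-bad⁺ : ∀ {n p} → Bad n p → p ∈ bad n
∈-bad⁺ {suc n} {suc i , j} (1≤j , s≤s j≤i , s≤s i<n) = ∈-concatMap⁺ (λ i → map (i ,_) (range 1 (i ∸ 1)))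
  (lose (∈-range⁺ (s≤s (ℕP.≤-trans 1≤j j≤i)) i<n) (∈-map⁺ (suc i ,_) (∈-range⁺ 1≤j j≤i)))

-- The order of GT_n and its local inequalities

⪯-intro : ∀ {i j k l} → k ℕ.+ j ℕ.≤ l ℕ.+ i → j ℕ.≤ l → (i , j) ⪯GT (k , l)
⪯-intro {i} {j} {k} {l} le j≤l = subst₂ ℤ._≤_ (eq (+ k) (+ j) (+ i)) (eq′ (+ l) (+ i) (+ j))
  (ℤP.+-monoˡ-≤ (- + i - + j) (ℤ.+≤+ le)) , j≤l
  where
  open +-*-Solver
  eq : ∀ k j i → k + j + (- i - j) ≡ k - i
  eq = solve 3 (λ k j i → k :+ j :+ (:- i :- j) := k :- i) refl
  eq′ : ∀ l i j → l + i + (- i - j) ≡ l - j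
  eq′ = solve 3 (λ l i j → l :+ i :+ (:- i :- j) := l :- j) refl

⪯-elim : ∀ {i j k l} → (i , j) ⪯GT (k , l) → k ℕ.+ j ℕ.≤ l ℕ.+ i
⪯-elim {i} {j} {k} {l} (le , _) = ℤP.drop‿+≤+ (subst₂ ℤ._≤_ (eq (+ k) (+ i) (+ j)) (eq′ (+ l) (+ j) (+ i))
  (ℤP.+-monoˡ-≤ (+ i + + j) le))
  where
  open +-*-Solver
  eq : ∀ k i j → k - i + (i + j) ≡ k + j
  eq = solve 3 (λ k i j → k :- i :+ (i :+ j) := k :+ j) refl
  eq′ : ∀ l j i → l - j + (i + j) ≡ l + i
  eq′ = solve 3 (λ l j i → l :- j :+ (i :+ j) := l :+ i) refl

module _ {n : ℕ} {a : Arr} where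

  module _ (op : OrderPreserving n a) where

    vertical : ∀ {i j} → 1 ℕ.≤ j → j ℕ.≤ i → i ℕ.< n → a (suc i) j ℤ.≤ a i j
    vertical {i} {j} 1≤j j≤i i<n = op (suc i) j i j
      (1≤j , ℕP.m≤n⇒m≤1+n j≤i , i<n) (1≤j , j≤i , ℕP.<⇒≤ i<n)
      (⪯-intro (ℕP.≤-trans (ℕP.≤-reflexive (ℕP.+-comm i j)) (ℕP.+-monoʳ-≤ j (ℕP.n≤1+n i))) ℕP.≤-refl)

    diagonal : ∀ {i j} → 1 ℕ.≤ j → j ℕ.≤ i → i ℕ.< n → a i j ℤ.≤ a (suc i) (suc j)
    diagonal {i} {j} 1≤j j≤i i<n = op i j (suc i) (suc j)
      (1≤j , j≤i , ℕP.<⇒≤ i<n) (s≤s z≤n , s≤s j≤i , i<n)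
      (⪯-intro (ℕP.≤-reflexive (cong suc (ℕP.+-comm i j))) (ℕP.n≤1+n j))

    horizontal : ∀ {i j} → 1 ℕ.≤ j → j ℕ.< i → i ℕ.≤ n → a i j ℤ.≤ a i (suc j)
    horizontal {suc i} 1≤j (s≤s j≤i) i≤n = ℤP.≤-trans (vertical 1≤j j≤i i≤n) (diagonal 1≤j j≤i i≤n)

  -- (i,j) ⪯ (k,l) is reached by going first up column j to row k - (l - j), then along the diagonal;
  -- in the other order the path could leave the triangle.
  local⇒orderPreserving :
    (∀ {i j} → 1 ℕ.≤ j → j ℕ.≤ i → i ℕ.< n → a (suc i) j ℤ.≤ a i j) →
    (∀ {i j} → 1 ℕ.≤ j → j ℕ.≤ i → i ℕ.< n → a i j ℤ.≤ a (suc i) (suc j)) →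
    OrderPreserving n a
  local⇒orderPreserving vert diag i j k l (1≤j , j≤i , i≤n) (_ , l≤k , k≤n) rel@(_ , j≤l) =
    subst₂ (λ x y → a x j ℤ.≤ a y l) (ℕP.m∸n+n≡m h≤i) (ℕP.m+[n∸m]≡n d≤k)
      (ℤP.≤-trans (column 1≤j j≤h (i ∸ h) (subst (ℕ._≤ n) (sym (ℕP.m∸n+n≡m h≤i)) i≤n))
        (subst (λ y → a h j ℤ.≤ a (d ℕ.+ h) y) (ℕP.m∸n+n≡m j≤l)
          (slant 1≤j j≤h d (subst (ℕ._≤ n) (sym (ℕP.m+[n∸m]≡n d≤k)) k≤n))))
    where
    column : ∀ {i j} → 1 ℕ.≤ j → j ℕ.≤ i → ∀ s → s ℕ.+ i ℕ.≤ n → a (s ℕ.+ i) j ℤ.≤ a i j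
    column 1≤j j≤i zero    le = ℤP.≤-refl
    column 1≤j j≤i (suc s) le = ℤP.≤-trans (vert 1≤j (ℕP.≤-trans j≤i (ℕP.m≤n+m _ s)) le)
                                  (column 1≤j j≤i s (ℕP.<⇒≤ le))
    slant : ∀ {i j} → 1 ℕ.≤ j → j ℕ.≤ i → ∀ s → s ℕ.+ i ℕ.≤ n → a i j ℤ.≤ a (s ℕ.+ i) (s ℕ.+ j)
    slant 1≤j j≤i zero    le = ℤP.≤-refl
    slant 1≤j j≤i (suc s) le = ℤP.≤-trans (slant 1≤j j≤i s (ℕP.<⇒≤ le))
      (diag (ℕP.≤-trans 1≤j (ℕP.m≤n+m _ s)) (ℕP.+-monoʳ-≤ s j≤i) le)
    d h : ℕ
    d = l ∸ j
    h = k ∸ d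
    d≤k : d ℕ.≤ k
    d≤k = ℕP.≤-trans (ℕP.m∸n≤m l j) l≤k
    j≤h : j ℕ.≤ h
    j≤h = ℕP.m+n≤o⇒m≤o∸n j (subst (ℕ._≤ k) (sym (ℕP.m+[n∸m]≡n j≤l)) l≤k)
    h≤i : h ℕ.≤ i
    h≤i = ℕP.m≤n+o⇒m∸n≤o k d (ℕP.+-cancelʳ-≤ j k (d ℕ.+ i) (subst (k ℕ.+ j ℕ.≤_)
      (trans (cong (ℕ._+ i) (sym (ℕP.m∸n+n≡m j≤l))) (trans (ℕP.+-assoc d j i)
        (trans (cong (d ℕ.+_) (ℕP.+-comm j i)) (sym (ℕP.+-assoc d i j))))) (⪯-elim {i} {j} {k} {l} rel)))

-- Equalities within a row and the diamonds they collapse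

private
  _≟P_ : (p q : Pt) → Dec (p ≡ q)
  _≟P_ = ≡-dec ℕ._≟_ ℕ._≟_

Equal : Arr → Pt → Set
Equal a (i , j) = a i j ≡ a i (suc j)

Equal? : ∀ a p → Dec (Equal a p)
Equal? a (i , j) = a i j ℤ.≟ a i (suc j)

Equal-resp : ∀ n {a b p} → p ∈ bad n → a ≈[ n ] b → Equal a p → Equal b p
Equal-resp n {p = i , j} p∈ a≈b eq with 1≤j , j<i , i<n ← ∈-bad⁻ n p∈ =
  trans (sym (a≈b i j (1≤j , ℕP.<⇒≤ j<i , ℕP.<⇒≤ i<n)))
    (trans eq (a≈b i (suc j) (s≤s z≤n , j<i , ℕP.<⇒≤ i<n)))

squeeze : ∀ {x y z : ℤ} → x ℤ.≤ y → y ℤ.≤ z → x ≡ z → x ≡ y × y ≡ z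
squeeze x≤y y≤z refl = ℤP.≤-antisym x≤y y≤z , ℤP.≤-antisym y≤z x≤y

module _ {n : ℕ} {a : Arr} (op : OrderPreserving n a) where

  -- The entry above two neighbours lies between them, as does the entry below them in
  -- `Equal⇒lower`.
  Equal⇒upper : ∀ {i j} → Bad n (suc i , j) → Equal a (suc i , j) →
                a (suc i) j ≡ a i j × a i j ≡ a (suc i) (suc j)
  Equal⇒upper (1≤j , s≤s j≤i , i<n) = squeeze
    (vertical op 1≤j j≤i (ℕP.<⇒≤ i<n)) (diagonal op 1≤j j≤i (ℕP.<⇒≤ i<n))

  Equal⇒lower : ∀ {i j} → Bad n (i , j) → Equal a (i , j) →
                a i j ≡ a (suc i) (suc j) × a (suc i) (suc j) ≡ a i (suc j)
  Equal⇒lower (1≤j , j<i , i<n) = squeeze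
    (diagonal op 1≤j (ℕP.<⇒≤ j<i) i<n) (vertical op (s≤s z≤n) j<i i<n)

  -- Equal left and right corners squeeze the upper and lower ones. Being constant on a diamond thus
  -- amounts to the single equation `Equal a s`.
  Equal⇒diamond : ∀ {s} → s ∈ bad n → Equal a s → ∀ {p q} → (p , q) ∈ diamond s →
                  a (proj₁ p) (proj₂ p) ≡ a (proj₁ q) (proj₂ q)
  Equal⇒diamond {zero  , j} s∈ eq _ with _ , () , _ ← ∈-bad⁻ n s∈
  Equal⇒diamond {suc i , j} s∈ eq (here refl)                         = proj₁ (Equal⇒upper (∈-bad⁻ n s∈) eq)
  Equal⇒diamond {suc i , j} s∈ eq (there (here refl))                 = proj₁ (Equal⇒lower (∈-bad⁻ n s∈) eq)
  Equal⇒diamond {suc i , j} s∈ eq (there (there (here refl)))         = proj₂ (Equal⇒upper (∈-bad⁻ n s∈) eq)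
  Equal⇒diamond {suc i , j} s∈ eq (there (there (there (here refl)))) = proj₂ (Equal⇒lower (∈-bad⁻ n s∈) eq)

  -- Both entries in the row above equal the middle entry `a (suc i) (suc j)` shared by the two
  -- equalities.
  Equal-pair⇒above : ∀ {i j} → Bad n (suc i , j) → Bad n (suc i , suc j) →
                     Equal a (suc i , j) → Equal a (suc i , suc j) → Bad n (i , j) × Equal a (i , j)
  Equal-pair⇒above b@(1≤j , _ , si<n) b′@(_ , s≤s j<i , _) eq eq′ =
    (1≤j , j<i , ℕP.<⇒≤ si<n) ,
    trans (proj₂ (Equal⇒upper b eq)) (proj₁ (Equal⇒upper b′ eq′))

  -- Such a point can be inserted into a non-adjacent set of equalities of `a` without creating
  -- adjacent points.
  Isolated : Pt → Set
  Isolated p = p ∈ bad n × Equal a p × (∀ {q} → q ∈ bad n → Equal a q → right q ≢ p × q ≢ right p)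

  -- Two adjacent equalities force one in the row above, so a topmost equality is isolated.
  isolate : ∀ i {j} → Bad n (i , j) → Equal a (i , j) → ∃ Isolated
  isolate (suc i) {j} b eq
    with any? (λ q → Equal? a q ×-dec ((right q ≟P (suc i , j)) ⊎-dec (q ≟P (suc i , suc j)))) (bad n)
  ... | no none = (suc i , j) , ∈-bad⁺ b , eq , λ q∈ eq′ →
          (λ e → none (lose q∈ (eq′ , inj₁ e))) , (λ e → none (lose q∈ (eq′ , inj₂ e)))
  ... | yes some with find some
  ... | _ , q∈ , eq′ , inj₁ refl = let b′ , e = Equal-pair⇒above (∈-bad⁻ n q∈) b eq′ eq in isolate i b′ e
  ... | _ , q∈ , eq′ , inj₂ refl = let b′ , e = Equal-pair⇒above b (∈-bad⁻ n q∈) eq eq′ in isolate i b′ e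

-- `OmegaSet n k []` carries no edge condition, so it serves as the ambient set of all order
-- preserving extensions of `k`; the points of `S` cut out the others by equalities.
OmegaSet-⇒ : ∀ {n k S a} → OmegaSet n k S a → OmegaSet n k [] a × All (Equal a) S
OmegaSet-⇒ {S = S} (op , bottom , const) = (op , bottom , λ _ _ ()) , All.tabulate λ {s} s∈ →
  -- The first and third edges of the diamond lead from the left corner over the upper one to the
  -- right one.
  trans (const _ _ (lose s∈ (here refl))) (const _ _ (lose s∈ (there (there (here refl)))))

OmegaSet-⇐ : ∀ {n k S a} → All (_∈ bad n) S → OmegaSet n k [] a → All (Equal a) S → OmegaSet n k S a
OmegaSet-⇐ S⊆ (op , bottom , _) eqs = op , bottom , λ p q e∈ → let s , s∈ , e∈s = find e∈ in
  Equal⇒diamond op (All.lookup S⊆ s∈) (All.lookup eqs s∈) e∈s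

-- The weak inequalities are the cover relations and generate the order; the strict ones exclude
-- equality at the points of `bad n`.
MonotoneTriangle-⇒ : ∀ {n k a} → MonotoneTriangle n k a → OmegaSet n k [] a × All (¬_ ∘ Equal a) (bad n)
MonotoneTriangle-⇒ {n} (bottom , vert , diag , strict) =
  (local⇒orderPreserving (λ 1≤j j≤i i<n → vert _ _ 1≤j (s≤s j≤i) i<n) (diag _ _) , bottom , λ _ _ ()) ,
  All.tabulate λ p∈ eq → let 1≤j , j<i , i<n = ∈-bad⁻ n p∈ in ℤP.<-irrefl eq (strict _ _ 1≤j j<i i<n)

MonotoneTriangle-⇐ : ∀ {n k a} → OmegaSet n k [] a → All (¬_ ∘ Equal a) (bad n) → MonotoneTriangle n k a
MonotoneTriangle-⇐ (op , bottom , _) neqs = bottom ,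
  (λ { (suc i) j 1≤j (s≤s j≤i) i<n → vertical op 1≤j j≤i i<n }) ,
  (λ i j → diagonal op) ,
  (λ i j 1≤j j<i i<n → ℤP.≤∧≢⇒< (horizontal op 1≤j j<i (ℕP.<⇒≤ i<n))
                         (All.lookup neqs (∈-bad⁺ (1≤j , j<i , i<n))))

-- Signed sums over sublists

∈-sublists⇒All : {A : Set} {B : A → Set} {xs S : List A} → All B xs → S ∈ sublists xs → All B S
∈-sublists⇒All {xs = []}     _        (here refl) = []
∈-sublists⇒All {xs = x ∷ xs} (b ∷ bs) S∈ with ∈-++⁻ (map (x ∷_) (sublists xs)) S∈
... | inj₂ S∈′ = ∈-sublists⇒All bs S∈′
... | inj₁ S∈′ with _ , T∈ , refl ← ∈-map⁻ (x ∷_) S∈′ = b ∷ ∈-sublists⇒All bs T∈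

[]∈sublists : {A : Set} (xs : List A) → [] ∈ sublists xs
[]∈sublists []       = here refl
[]∈sublists (x ∷ xs) = ∈-++⁺ʳ (map (x ∷_) (sublists xs)) ([]∈sublists xs)

∑-sublists-∷ : {A : Set} (x : A) (xs : List A) (W : List A → ℤ) →
               ∑ (sublists (x ∷ xs)) W ≡ ∑ (sublists xs) (W ∘ (x ∷_)) + ∑ (sublists xs) W
∑-sublists-∷ x xs W = trans (∑-++ (map (x ∷_) (sublists xs)) (sublists xs) W)
  (cong (_+ ∑ (sublists xs) W) (∑-map (x ∷_) (sublists xs) W))

-- A nonempty sublist begins with a member of `xs`, so only the empty one survives.
∑-sublists-[] : {A : Set} (xs : List A) (W : List A → ℤ) →
                (∀ {x} → x ∈ xs → ∀ S → W (x ∷ S) ≡ 0ℤ) → ∑ (sublists xs) W ≡ W []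
∑-sublists-[] []       W zeros = ℤP.+-identityʳ _
∑-sublists-[] (x ∷ xs) W zeros = trans (∑-sublists-∷ x xs W)
  (trans (cong₂ _+_ (∑-zero (sublists xs) λ {S} _ → zeros (here refl) S) (∑-sublists-[] xs W (zeros ∘ there)))
         (ℤP.+-identityˡ _))

-- Sublists are paired by inserting or deleting `p`, and each pair cancels. The predicate `B` hands
-- the toggling hypothesis what is known about the other members.
∑-sublists-toggle : {A : Set} {B : A → Set} {p : A} {xs : List A} (W : List A → ℤ) → All B xs → p ∈ xs →
                    (∀ {S₁ S₂} → All B S₁ → All B S₂ → W (S₁ ++ p ∷ S₂) + W (S₁ ++ S₂) ≡ 0ℤ) →
                    ∑ (sublists xs) W ≡ 0ℤ
∑-sublists-toggle {xs = x ∷ xs} W (b ∷ bs) (here refl) toggle = trans (∑-sublists-∷ x xs W)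
  (trans (sym (∑-+ (sublists xs) _ _)) (∑-zero (sublists xs) λ S∈ → toggle [] (∈-sublists⇒All bs S∈)))
∑-sublists-toggle {xs = x ∷ xs} W (b ∷ bs) (there p∈) toggle = trans (∑-sublists-∷ x xs W)
  -- A chosen `x` in front of `p` is absorbed into the weight and becomes part of `S₁`.
  (cong₂ _+_ (∑-sublists-toggle (W ∘ (x ∷_)) bs p∈ (toggle ∘ (b ∷_)))
             (∑-sublists-toggle W bs p∈ toggle))

-- Non-adjacent sets of diamonds and Q_ess

NonAdjacent : List Pt → Set
NonAdjacent S = ∀ {p} → p ∈ S → ¬ (right p ∈ S)

∈⇒Contained : ∀ {S p} → p ∈ S → Contained S p
∈⇒Contained p∈ = All.tabulate λ e∈ → lose p∈ e∈

-- The only other diamonds meeting the two edges of G_{ij} at (i-1,j) are G_{i-1,j-1} and G_{i-1,j},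
-- which are adjacent.
Contained⇒∈ : ∀ n {S p} → p ∈ bad n → NonAdjacent S → Contained S p → p ∈ S
Contained⇒∈ n {p = zero  , j} p∈ na _ with _ , () , _ ← ∈-bad⁻ n p∈
Contained⇒∈ n {S} {p = suc i , j} p∈ na (e₁∈ ∷ _ ∷ e₃∈ ∷ _) with edge₁ (find e₁∈) | edge₃ (find e₃∈)
  where
  edge₁ : (∃ λ s → s ∈ S × ((suc i , j) , (i , j)) ∈ diamond s) →
          (suc i , j) ∈ S ⊎ (∃ λ s → s ∈ S × right s ≡ (i , j))
  edge₁ ((zero  , _) , _  , here ())
  edge₁ ((suc _ , _) , s∈ , here refl)                         = inj₁ s∈
  edge₁ ((suc _ , _) , _  , there (there (here ())))
  edge₁ (_           , s∈ , there (there (there (here refl)))) = inj₂ (_ , s∈ , refl)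
  edge₃ : (∃ λ s → s ∈ S × ((i , j) , (suc i , suc j)) ∈ diamond s) → (suc i , j) ∈ S ⊎ (i , j) ∈ S
  edge₃ ((suc _ , _) , _  , here ())
  edge₃ (_           , s∈ , there (here refl))         = inj₂ s∈
  edge₃ ((suc _ , _) , s∈ , there (there (here refl))) = inj₁ s∈
  edge₃ (_           , _  , there (there (there (here ()))))
... | inj₁ p∈S             | _         = p∈S
... | _                    | inj₁ p∈S  = p∈S
... | inj₂ (_ , s∈ , refl) | inj₂ s′∈  = contradiction s′∈ (na s∈)

-- By `Contained⇒∈` the points of I(G(S)) lie in `S`. This is saturation, it transfers non-adjacency
-- to I(G(S)), and it makes closedness vacuous.
NonAdjacent⇒Qess : ∀ n {S} → NonAdjacent S → Qess n S
NonAdjacent⇒Qess n {S} na =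
  All.tabulate (λ p∈ → Contained⇒∈ n p∈ na) ,
  All.tabulate (λ _ p∈I rp∈I → contradiction (InI⇒∈ rp∈I) (na (InI⇒∈ p∈I))) ,
  All.tabulate (λ _ (p∈I , rp∈I) → na (InI⇒∈ p∈I) (InI⇒∈ rp∈I))
  where
  InI⇒∈ : ∀ {p} → InI n S p → p ∈ S
  InI⇒∈ (p∈ , c) = Contained⇒∈ n p∈ na c

Qess⇒NonAdjacent : ∀ n {S} → All (_∈ bad n) S → Qess n S → NonAdjacent S
Qess⇒NonAdjacent n S⊆ (_ , _ , na) p∈ rp∈ = All.lookup na (All.lookup S⊆ p∈)
  ((All.lookup S⊆ p∈ , ∈⇒Contained p∈) , (All.lookup S⊆ rp∈ , ∈⇒Contained rp∈))

sign-suc : ∀ m → sign (suc m) ≡ - sign m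
sign-suc zero          = refl
sign-suc (suc zero)    = refl
sign-suc (suc (suc m)) = sign-suc m

-- The signed weight of a single array

module _ (n : ℕ) (a : Arr) {Q : List Pt → Set} (Q? : ∀ S → Dec (Q S))
         (Q⇒NonAdjacent : ∀ {S} → All (_∈ bad n) S → Q S → NonAdjacent S)
         (NonAdjacent⇒Q : ∀ {S} → NonAdjacent S → Q S) where

  -- The contribution of the array `a` to the summand of `S`, with `Q` standing for `Qess n`.
  weight : List Pt → ℤ
  weight S = [ Q? S ]· (sign (length S) * [ all? (Equal? a) S ]· 1ℤ)

  weight-no : ∀ {S} → ¬ All (Equal a) S → weight S ≡ 0ℤ
  weight-no {S} ¬eqs = trans (cong (λ z → [ Q? S ]· (sign (length S) * z)) ([]·-no (all? (Equal? a) S) ¬eqs 1ℤ))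
    (trans (cong ([ Q? S ]·_) (ℤP.*-zeroʳ (sign (length S)))) ([]·-zero (Q? S)))

  weight-yes : ∀ {S} → All (Equal a) S → weight S ≡ [ Q? S ]· sign (length S)
  weight-yes {S} eqs = cong ([ Q? S ]·_)
    (trans (cong (sign (length S) *_) ([]·-yes (all? (Equal? a) S) eqs 1ℤ)) (ℤP.*-identityʳ _))

  -- If some other point is not an equality of `a`, both weights vanish. Otherwise inserting the
  -- isolated `p` preserves `Q` in both directions and only flips the sign.
  weight-toggle : (op : OrderPreserving n a) → ∀ {p} → Isolated op p → ∀ {S₁ S₂} →
                  All (_∈ bad n) S₁ → All (_∈ bad n) S₂ → weight (S₁ ++ p ∷ S₂) + weight (S₁ ++ S₂) ≡ 0ℤ
  weight-toggle op {p} (p∈ , eq , alone) {S₁} {S₂} S₁⊆ S₂⊆ = go (all? (Equal? a) S)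
    where
    open ≡-Reasoning
    S S⁺ : List Pt
    S  = S₁ ++ S₂
    S⁺ = S₁ ++ p ∷ S₂
    S⊆ : All (_∈ bad n) S
    S⊆ = AllP.++⁺ S₁⊆ S₂⊆
    S⁺⊆ : All (_∈ bad n) S⁺
    S⁺⊆ = AllP.++⁺ S₁⊆ (p∈ ∷ S₂⊆)
    drop : All (Equal a) S⁺ → All (Equal a) S
    drop eqs = AllP.++⁺ (AllP.++⁻ˡ S₁ eqs) (All.tail (AllP.++⁻ʳ S₁ eqs))
    put : All (Equal a) S → All (Equal a) S⁺
    put eqs = AllP.++⁺ (AllP.++⁻ˡ S₁ eqs) (eq ∷ AllP.++⁻ʳ S₁ eqs)
    length-S⁺ : length S⁺ ≡ suc (length S)
    length-S⁺ = trans (length-++ S₁) (trans (ℕP.+-suc (length S₁) _) (cong suc (sym (length-++ S₁))))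
    widen : ∀ {q} → q ∈ S → q ∈ S⁺
    widen q∈ with ∈-++⁻ S₁ q∈
    ... | inj₁ q∈₁ = ∈-++⁺ˡ q∈₁
    ... | inj₂ q∈₂ = ∈-++⁺ʳ S₁ (there q∈₂)
    narrow : ∀ {q} → q ∈ S⁺ → q ≡ p ⊎ q ∈ S
    narrow q∈ with ∈-++⁻ S₁ q∈
    ... | inj₁ q∈₁         = inj₂ (∈-++⁺ˡ q∈₁)
    ... | inj₂ (here q≡p)  = inj₁ q≡p
    ... | inj₂ (there q∈₂) = inj₂ (∈-++⁺ʳ S₁ q∈₂)
    to : Q S⁺ → Q S
    to q = NonAdjacent⇒Q λ q∈ rq∈ → Q⇒NonAdjacent S⁺⊆ q (widen q∈) (widen rq∈)
    from : All (Equal a) S → Q S → Q S⁺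
    from eqs q = NonAdjacent⇒Q na
      where
      na : NonAdjacent S⁺
      na q∈ rq∈ with narrow q∈ | narrow rq∈
      ... | inj₁ refl | inj₁ ()
      ... | inj₁ refl | inj₂ rq∈′ = proj₂ (alone (All.lookup S⊆ rq∈′) (All.lookup eqs rq∈′)) refl
      ... | inj₂ q∈′  | inj₁ rq≡p = proj₁ (alone (All.lookup S⊆ q∈′) (All.lookup eqs q∈′)) rq≡p
      ... | inj₂ q∈′  | inj₂ rq∈′ = Q⇒NonAdjacent S⊆ q q∈′ rq∈′
    go : Dec (All (Equal a) S) → weight S⁺ + weight S ≡ 0ℤ
    go (no ¬eqs) = cong₂ _+_ (weight-no {S⁺} (¬eqs ∘ drop)) (weight-no {S} ¬eqs)
    go (yes eqs) = begin
      weight S⁺ + weight S   ≡⟨ cong₂ _+_ (weight-yes (put eqs)) (weight-yes eqs) ⟩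
      [ Q? S⁺ ]· sign (length S⁺) + w
        ≡⟨ cong (λ z → z + w) ([]·-⇔ (Q? S⁺) (Q? S) to (from eqs) (sign (length S⁺))) ⟩
      [ Q? S ]· sign (length S⁺) + w
        ≡⟨ cong (λ z → [ Q? S ]· z + w) (trans (cong sign length-S⁺) (sign-suc (length S))) ⟩
      [ Q? S ]· (- sign (length S)) + w
        ≡⟨ cong (λ z → z + w) ([]·-neg (Q? S) (sign (length S))) ⟩
      - w + w                ≡⟨ ℤP.+-inverseˡ w ⟩
      0ℤ                     ∎
      where
      w : ℤ
      w = [ Q? S ]· sign (length S)

  -- Without equalities only the empty set has nonzero weight, namely 1. With an equality there is
  -- an isolated one, and toggling it cancels everything.
  ∑-weight : OrderPreserving n a →
             ∑ (sublists (bad n)) weight ≡ [ all? (¬? ∘ Equal? a) (bad n) ]· 1ℤ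
  ∑-weight op = go (all? (¬? ∘ Equal? a) (bad n))
    where
    go : (d : Dec (All (¬_ ∘ Equal a) (bad n))) → ∑ (sublists (bad n)) weight ≡ [ d ]· 1ℤ
    go (yes neqs) = trans (∑-sublists-[] (bad n) weight λ {p} p∈ S →
                             weight-no {p ∷ S} (All.lookup neqs p∈ ∘ All.head))
                          ([]·-yes (Q? []) (NonAdjacent⇒Q λ ()) _)
    go (no ¬neqs) with p , p∈ , ¬¬eq ← find (AllP.¬All⇒Any¬ (¬? ∘ Equal? a) (bad n) ¬neqs) =
      let q , iso@(q∈ , _) = isolate op (proj₁ p) (∈-bad⁻ n p∈) (decidable-stable (Equal? a p) ¬¬eq) in
      ∑-sublists-toggle weight (All.tabulate λ q∈ → q∈) q∈ (weight-toggle op iso)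

-- Every cardinality is recomputed as a filter of one list `L` of order preserving extensions. The
-- sums over arrays and over sets can then be exchanged.
inclusion-exclusion : ∀ n k {α ω} → Count n (MonotoneTriangle n k) α →
                      (∀ S → S ∈ QessList n → Count n (OmegaSet n k S) (ω S)) → + α ≡ QessSum n ω
inclusion-exclusion n k {α} {ω} cα cω = begin
  + α
    ≡⟨ cong (λ m → + m) (Count-unique n cα (Count-filter n none? none-resp
         (MonotoneTriangle-⇐ {n} {k}) (MonotoneTriangle-⇒ {n} {k}) c₀)) ⟩
  + length (filter none? L)
    ≡⟨ length-filter-∑ none? L ⟩
  ∑ L (λ a → [ none? a ]· 1ℤ)
    ≡⟨ ∑-cong L (λ {a} a∈ → sym (∑-weight n a (Qess? n) (Qess⇒NonAdjacent n) (NonAdjacent⇒Qess n)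
         (proj₁ (All.lookup (Count.sound c₀) a∈)))) ⟩
  ∑ L (λ a → ∑ (sublists (bad n)) λ S → [ Qess? n S ]· (sign (length S) * [ all? (Equal? a) S ]· 1ℤ))
    ≡⟨ ∑-cong L (λ {a} _ → sym (∑-filter (Qess? n) (sublists (bad n)) _)) ⟩
  ∑ L (λ a → ∑ (QessList n) λ S → sign (length S) * [ all? (Equal? a) S ]· 1ℤ)
    ≡⟨ ∑-swap L (QessList n) (λ a S → sign (length S) * [ all? (Equal? a) S ]· 1ℤ) ⟩
  ∑ (QessList n) (λ S → ∑ L λ a → sign (length S) * [ all? (Equal? a) S ]· 1ℤ)
    ≡⟨ ∑-cong (QessList n) (λ {S} S∈ → trans (∑-*ˡ (sign (length S)) L (λ a → [ all? (Equal? a) S ]· 1ℤ))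
         (cong (sign (length S) *_) (sym (ω-∑ S∈)))) ⟩
  QessSum n ω ∎
  where
  open ≡-Reasoning
  -- The empty set belongs to Q_ess, so the hypothesis on `ω` itself supplies the ambient list.
  c₀ : Count n (OmegaSet n k []) (ω [])
  c₀ = cω [] (∈-filter⁺ (Qess? n) ([]∈sublists (bad n)) (NonAdjacent⇒Qess n λ ()))
  L : List Arr
  L = Count.elems c₀
  none? : ∀ a → Dec (All (¬_ ∘ Equal a) (bad n))
  none? a = all? (¬? ∘ Equal? a) (bad n)
  none-resp : ∀ {a b} → a ≈[ n ] b → All (¬_ ∘ Equal a) (bad n) → All (¬_ ∘ Equal b) (bad n)
  none-resp a≈b neqs = All.tabulate λ p∈ eq → All.lookup neqs p∈ (Equal-resp n p∈ (≈-sym n a≈b) eq)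
  ω-∑ : ∀ {S} → S ∈ QessList n → + ω S ≡ ∑ L (λ a → [ all? (Equal? a) S ]· 1ℤ)
  ω-∑ {S} S∈ = trans (cong (λ m → + m) (Count-unique n (cω S S∈) (Count-filter n (λ a → all? (Equal? a) S)
    (λ a≈b eqs → All.tabulate λ p∈ → Equal-resp n (All.lookup S⊆ p∈) a≈b (All.lookup eqs p∈))
    (OmegaSet-⇐ {n} {k} S⊆) (OmegaSet-⇒ {n} {k}) c₀))) (length-filter-∑ (λ a → all? (Equal? a) S) L)
    where
    S⊆ : All (_∈ bad n) S
    S⊆ = ∈-sublists⇒All (All.tabulate λ p∈ → p∈) (proj₁ (∈-filter⁻ (Qess? n) {xs = sublists (bad n)} S∈))

-- Summation of polynomials over intervals

open ℚ-Solver using (solve; _:=_; _:+_; _:*_; _:-_; :-_) renaming (con to :con)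

ι : ℤ → ℚ
ι z = z ℚ./ 1

private
  -- The normal form of `z / 1`, which does not reduce by itself for a variable `z`.
  integral : ℤ → ℚ
  integral z = mkℚ z 0 (Coprimality.sym (Coprimality.1-coprimeTo ℤ.∣ z ∣))

  ι≡integral : ∀ z → ι z ≡ integral z
  ι≡integral z = ℚP.↥p/↧p≡p (integral z)

ι-+ : ∀ x y → ι (x ℤ.+ y) ≡ ι x ℚ.+ ι y
-- Adding two fractions of denominator 1 unfolds to the quotient of `x * 1 + y * 1` by 1.
ι-+ x y = trans (cong ι (sym (cong₂ ℤ._+_ (ℤP.*-identityʳ x) (ℤP.*-identityʳ y))))
                (sym (cong₂ ℚ._+_ (ι≡integral x) (ι≡integral y)))

ι-- : ∀ x y → ι (x ℤ.- y) ≡ ι x ℚ.- ι y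
ι-- x y = begin
  ι (x ℤ.- y)                       ≡⟨ cancel (ι (x ℤ.- y)) (ι y) ⟩
  ι (x ℤ.- y) ℚ.+ ι y ℚ.- ι y       ≡⟨ cong (ℚ._- ι y) (sym (ι-+ (x ℤ.- y) y)) ⟩
  ι (x ℤ.- y ℤ.+ y) ℚ.- ι y         ≡⟨ cong (λ z → ι z ℚ.- ι y) (minus-plus x y) ⟩
  ι x ℚ.- ι y                       ∎
  where
  open ≡-Reasoning
  cancel : ∀ u v → u ≡ u ℚ.+ v ℚ.- v
  cancel = solve 2 (λ u v → u := u :+ v :- v) refl
  minus-plus : ∀ x y → x ℤ.- y ℤ.+ y ≡ x
  minus-plus x y = trans (ℤP.+-assoc x (ℤ.- y) y) (trans (cong (ℤ._+_ x) (ℤP.+-inverseˡ y)) (ℤP.+-identityʳ x))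

recip : ℕ → ℚ
recip i = 1/ integral (+ suc i)

recip-inverse : ∀ i → recip i ℚ.* ι (+ suc i) ≡ 1ℚ
recip-inverse i = trans (cong (recip i ℚ.*_) (ι≡integral (+ suc i))) (ℚP.*-inverseˡ (integral (+ suc i)))

-- Unlike in `Poly`, the type of variables is arbitrary, so that a summation variable can be
-- adjoined as `nothing` and eliminated again.
data Expr (V : Set) : Set where
  con     : ℚ → Expr V
  var     : V → Expr V
  _⊞_ _⊠_ : Expr V → Expr V → Expr V

⟦_⟧ : {V : Set} → Expr V → (V → ℚ) → ℚ
⟦ con q ⟧ ρ = q
⟦ var v ⟧ ρ = ρ v
⟦ e ⊞ f ⟧ ρ = ⟦ e ⟧ ρ ℚ.+ ⟦ f ⟧ ρ
⟦ e ⊠ f ⟧ ρ = ⟦ e ⟧ ρ ℚ.* ⟦ f ⟧ ρ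

rename : {V W : Set} → (V → W) → Expr V → Expr W
rename r (con q) = con q
rename r (var v) = var (r v)
rename r (e ⊞ f) = rename r e ⊞ rename r f
rename r (e ⊠ f) = rename r e ⊠ rename r f

⟦rename⟧ : {V W : Set} (r : V → W) (e : Expr V) {ρ : W → ℚ} {σ : V → ℚ} →
           (∀ v → ρ (r v) ≡ σ v) → ⟦ rename r e ⟧ ρ ≡ ⟦ e ⟧ σ
⟦rename⟧ r (con q) eq = refl
⟦rename⟧ r (var v) eq = eq v
⟦rename⟧ r (e ⊞ f) eq = cong₂ ℚ._+_ (⟦rename⟧ r e eq) (⟦rename⟧ r f eq)
⟦rename⟧ r (e ⊠ f) eq = cong₂ ℚ._*_ (⟦rename⟧ r e eq) (⟦rename⟧ r f eq)

-- Falling factorials, the Newton form and antidifferences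

falling : ℕ → ℚ → ℚ
falling zero    x = 1ℚ
falling (suc i) x = falling i x ℚ.* (x ℚ.- ι (+ i))

ι-suc : ∀ i → ι (+ suc i) ≡ ι (+ i) ℚ.+ 1ℚ
ι-suc i = trans (cong (λ z → ι (+ z)) (sym (ℕP.+-comm i 1))) (ι-+ (+ i) 1ℤ)

falling-shift : ∀ i x → falling (suc i) (x ℚ.+ 1ℚ) ≡ (x ℚ.+ 1ℚ) ℚ.* falling i x
falling-shift zero    x = solve 1 (λ x → :con 1ℚ :* (x :+ :con 1ℚ :- :con 0ℚ) := (x :+ :con 1ℚ) :* :con 1ℚ) refl x
falling-shift (suc i) x = begin
  falling (suc i) (x ℚ.+ 1ℚ) ℚ.* (x ℚ.+ 1ℚ ℚ.- ι (+ suc i))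
    ≡⟨ cong₂ (λ u v → u ℚ.* (x ℚ.+ 1ℚ ℚ.- v)) (falling-shift i x) (ι-suc i) ⟩
  (x ℚ.+ 1ℚ) ℚ.* falling i x ℚ.* (x ℚ.+ 1ℚ ℚ.- (ι (+ i) ℚ.+ 1ℚ))
    ≡⟨ solve 3 (λ x f i → (x :+ :con 1ℚ) :* f :* (x :+ :con 1ℚ :- (i :+ :con 1ℚ)) :=
                          (x :+ :con 1ℚ) :* (f :* (x :- i))) refl x (falling i x) (ι (+ i)) ⟩
  (x ℚ.+ 1ℚ) ℚ.* (falling i x ℚ.* (x ℚ.- ι (+ i))) ∎
  where
  open ≡-Reasoning

-- The discrete power rule. After splitting off the common factor `falling i x`, what remains is (x
-- + 1) - (x - i) = i + 1, which `recip i` = 1/(i + 1) cancels.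
falling-Δ : ∀ i x → recip i ℚ.* falling (suc i) (x ℚ.+ 1ℚ) ≡ recip i ℚ.* falling (suc i) x ℚ.+ falling i x
falling-Δ i x = begin
  recip i ℚ.* falling (suc i) (x ℚ.+ 1ℚ)
    ≡⟨ cong (recip i ℚ.*_) (falling-shift i x) ⟩
  recip i ℚ.* ((x ℚ.+ 1ℚ) ℚ.* f)
    ≡⟨ solve 4 (λ r x f i → r :* ((x :+ :con 1ℚ) :* f) :=
                            r :* (f :* (x :- i)) :+ r :* (i :+ :con 1ℚ) :* f) refl (recip i) x f (ι (+ i)) ⟩
  recip i ℚ.* (f ℚ.* (x ℚ.- ι (+ i))) ℚ.+ recip i ℚ.* (ι (+ i) ℚ.+ 1ℚ) ℚ.* f
    ≡⟨ cong (λ u → recip i ℚ.* (f ℚ.* (x ℚ.- ι (+ i))) ℚ.+ u ℚ.* f)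
         (trans (cong (recip i ℚ.*_) (sym (ι-suc i))) (recip-inverse i)) ⟩
  recip i ℚ.* (f ℚ.* (x ℚ.- ι (+ i))) ℚ.+ 1ℚ ℚ.* f
    ≡⟨ cong (recip i ℚ.* (f ℚ.* (x ℚ.- ι (+ i))) ℚ.+_) (ℚP.*-identityˡ f) ⟩
  recip i ℚ.* (f ℚ.* (x ℚ.- ι (+ i))) ℚ.+ f ∎
  where
  open ≡-Reasoning
  f : ℚ
  f = falling i x

module _ {W : Set} where

  -- A polynomial in the variable nothing over the variables just w, written in the basis of falling factorials.
  newton : ℕ → List (Expr W) → (W → ℚ) → ℚ → ℚ
  newton i []       ρ x = 0ℚ
  newton i (c ∷ cs) ρ x = ⟦ c ⟧ ρ ℚ.* falling i x ℚ.+ newton (suc i) cs ρ x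

  -- The coefficients of  d · falling i + x · newton i cs,  using  x · falling i = falling (1 + i) + i · falling i.
  times-x : ℕ → Expr W → List (Expr W) → List (Expr W)
  times-x i d []       = d ∷ []
  times-x i d (c ∷ cs) = (d ⊞ (con (ι (+ i)) ⊠ c)) ∷ times-x (suc i) c cs

  add : List (Expr W) → List (Expr W) → List (Expr W)
  add []       ds       = ds
  add (c ∷ cs) []       = c ∷ cs
  add (c ∷ cs) (d ∷ ds) = (c ⊞ d) ∷ add cs ds

  -- Multiplication by an expression as an operator on Newton coefficients. A product becomes a
  -- composition, and falling factorials are only ever multiplied by the variable or by scalars.
  times : Expr (Maybe W) → List (Expr W) → List (Expr W)
  times (con q)        cs = map (con q ⊠_) cs
  times (var nothing)  cs = times-x 0 (con 0ℚ) cs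
  times (var (just w)) cs = map (var w ⊠_) cs
  times (e ⊞ f)        cs = add (times e cs) (times f cs)
  times (e ⊠ f)        cs = times e (times f cs)

  module _ (ρ : W → ℚ) (x : ℚ) where

    newton-map : ∀ i c cs → newton i (map (c ⊠_) cs) ρ x ≡ ⟦ c ⟧ ρ ℚ.* newton i cs ρ x
    newton-map i c []       = sym (ℚP.*-zeroʳ (⟦ c ⟧ ρ))
    newton-map i c (d ∷ ds) = trans (cong (⟦ c ⟧ ρ ℚ.* ⟦ d ⟧ ρ ℚ.* falling i x ℚ.+_) (newton-map (suc i) c ds))
      (solve 4 (λ c d f n → c :* d :* f :+ c :* n := c :* (d :* f :+ n)) refl (⟦ c ⟧ ρ) (⟦ d ⟧ ρ) (falling i x) (newton (suc i) ds ρ x))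

    newton-times-x : ∀ i d cs → newton i (times-x i d cs) ρ x ≡ ⟦ d ⟧ ρ ℚ.* falling i x ℚ.+ x ℚ.* newton i cs ρ x
    newton-times-x i d []       = cong (⟦ d ⟧ ρ ℚ.* falling i x ℚ.+_) (sym (ℚP.*-zeroʳ x))
    newton-times-x i d (c ∷ cs) = trans (cong ((⟦ d ⟧ ρ ℚ.+ ι (+ i) ℚ.* ⟦ c ⟧ ρ) ℚ.* falling i x ℚ.+_) (newton-times-x (suc i) c cs))
      (solve 6 (λ d c i f x n → (d :+ i :* c) :* f :+ (c :* (f :* (x :- i)) :+ x :* n) :=
                                d :* f :+ x :* (c :* f :+ n)) refl
         (⟦ d ⟧ ρ) (⟦ c ⟧ ρ) (ι (+ i)) (falling i x) x (newton (suc i) cs ρ x))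

    newton-add : ∀ i cs ds → newton i (add cs ds) ρ x ≡ newton i cs ρ x ℚ.+ newton i ds ρ x
    newton-add i []       ds       = sym (ℚP.+-identityˡ _)
    newton-add i (c ∷ cs) []       = sym (ℚP.+-identityʳ _)
    newton-add i (c ∷ cs) (d ∷ ds) = trans (cong ((⟦ c ⟧ ρ ℚ.+ ⟦ d ⟧ ρ) ℚ.* falling i x ℚ.+_) (newton-add (suc i) cs ds))
      (solve 5 (λ c d f m n → (c :+ d) :* f :+ (m :+ n) := c :* f :+ m :+ (d :* f :+ n)) refl
         (⟦ c ⟧ ρ) (⟦ d ⟧ ρ) (falling i x) (newton (suc i) cs ρ x) (newton (suc i) ds ρ x))

  newton-times : ∀ (σ : Maybe W → ℚ) e cs → newton 0 (times e cs) (σ ∘ just) (σ nothing) ≡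
                 ⟦ e ⟧ σ ℚ.* newton 0 cs (σ ∘ just) (σ nothing)
  newton-times σ (con q)        cs = newton-map _ _ 0 (con q) cs
  newton-times σ (var nothing)  cs = trans (newton-times-x _ _ 0 (con 0ℚ) cs) (ℚP.+-identityˡ _)
  newton-times σ (var (just w)) cs = newton-map _ _ 0 (var w) cs
  newton-times σ (e ⊞ f)        cs = trans (newton-add _ _ 0 (times e cs) (times f cs))
    (trans (cong₂ ℚ._+_ (newton-times σ e cs) (newton-times σ f cs)) (sym (ℚP.*-distribʳ-+ _ (⟦ e ⟧ σ) (⟦ f ⟧ σ))))
  newton-times σ (e ⊠ f)        cs = trans (newton-times σ e (times f cs))
    (trans (cong (⟦ e ⟧ σ ℚ.*_) (newton-times σ f cs)) (sym (ℚP.*-assoc (⟦ e ⟧ σ) (⟦ f ⟧ σ) _)))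

  coefficients : Expr (Maybe W) → List (Expr W)
  coefficients e = times e (con 1ℚ ∷ [])

  newton-coefficients : ∀ σ e → newton 0 (coefficients e) (σ ∘ just) (σ nothing) ≡ ⟦ e ⟧ σ
  newton-coefficients σ e = trans (newton-times σ e (con 1ℚ ∷ [])) (ℚP.*-identityʳ _)

  fallingᴱ : ℕ → Expr W → Expr W
  fallingᴱ zero    t = con 1ℚ
  fallingᴱ (suc i) t = fallingᴱ i t ⊠ (t ⊞ con (ℚ.- ι (+ i)))

  ⟦fallingᴱ⟧ : ∀ i t ρ → ⟦ fallingᴱ i t ⟧ ρ ≡ falling i (⟦ t ⟧ ρ)
  ⟦fallingᴱ⟧ zero    t ρ = refl
  ⟦fallingᴱ⟧ (suc i) t ρ = cong (ℚ._* (⟦ t ⟧ ρ ℚ.- ι (+ i))) (⟦fallingᴱ⟧ i t ρ)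

  antidifference : ℕ → List (Expr W) → (W → ℚ) → ℚ → ℚ
  antidifference i []       ρ x = 0ℚ
  antidifference i (c ∷ cs) ρ x = ⟦ c ⟧ ρ ℚ.* (recip i ℚ.* falling (suc i) x) ℚ.+ antidifference (suc i) cs ρ x

  antidifference-Δ : ∀ i cs ρ x → antidifference i cs ρ (x ℚ.+ 1ℚ) ≡ antidifference i cs ρ x ℚ.+ newton i cs ρ x
  antidifference-Δ i []       ρ x = refl
  antidifference-Δ i (c ∷ cs) ρ x = trans
    (cong₂ (λ u v → ⟦ c ⟧ ρ ℚ.* u ℚ.+ v) (falling-Δ i x) (antidifference-Δ (suc i) cs ρ x))
    (solve 5 (λ c u f m n → c :* (u :+ f) :+ (m :+ n) := c :* u :+ m :+ (c :* f :+ n)) refl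
       (⟦ c ⟧ ρ) (recip i ℚ.* falling (suc i) x) (falling i x) _ _)

  antidifferenceᴱ : ℕ → List (Expr W) → Expr W → Expr W
  antidifferenceᴱ i []       t = con 0ℚ
  antidifferenceᴱ i (c ∷ cs) t = (c ⊠ (con (recip i) ⊠ fallingᴱ (suc i) t)) ⊞ antidifferenceᴱ (suc i) cs t

  ⟦antidifferenceᴱ⟧ : ∀ i cs t ρ → ⟦ antidifferenceᴱ i cs t ⟧ ρ ≡ antidifference i cs ρ (⟦ t ⟧ ρ)
  ⟦antidifferenceᴱ⟧ i []       t ρ = refl
  ⟦antidifferenceᴱ⟧ i (c ∷ cs) t ρ = cong₂ (λ u v → ⟦ c ⟧ ρ ℚ.* (recip i ℚ.* u) ℚ.+ v)
    (⟦fallingᴱ⟧ (suc i) t ρ) (⟦antidifferenceᴱ⟧ (suc i) cs t ρ)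

  -- H(hi + 1) - H(lo) for an antidifference H; the shift by 1 includes the upper end.
  sumᴱ : Expr (Maybe W) → W → W → Expr W
  sumᴱ e lo hi = antidifferenceᴱ 0 (coefficients e) (var hi ⊞ con 1ℚ)
               ⊞ (con (ℚ.- 1ℚ) ⊠ antidifferenceᴱ 0 (coefficients e) (var lo))

-- Both ends are included. For a > b the absolute value yields a meaningless nonempty list.
interval : ℤ → ℤ → List ℤ
interval a b = applyUpTo (λ t → a ℤ.+ + t) (suc ℤ.∣ b ℤ.- a ∣)

+-∣-∣ : ∀ {a b} → a ℤ.≤ b → a ℤ.+ + ℤ.∣ b ℤ.- a ∣ ≡ b
+-∣-∣ {a} {b} a≤b = trans (cong (ℤ._+_ a) (ℤP.0≤i⇒+∣i∣≡i (ℤP.i≤j⇒0≤j-i a≤b)))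
  (trans (ℤP.+-comm a _) (trans (ℤP.+-assoc b (ℤ.- a) a)
    (trans (cong (ℤ._+_ b) (ℤP.+-inverseˡ a)) (ℤP.+-identityʳ b))))

∈-interval⁺ : ∀ {a b x} → a ℤ.≤ x → x ℤ.≤ b → x ∈ interval a b
∈-interval⁺ {a} {b} {x} a≤x x≤b = subst (_∈ interval a b) (+-∣-∣ a≤x)
  (∈-applyUpTo⁺ (λ t → a ℤ.+ + t) (s≤s (ℤP.drop‿+≤+ (subst₂ ℤ._≤_
    (sym (ℤP.0≤i⇒+∣i∣≡i (ℤP.i≤j⇒0≤j-i a≤x))) (sym (ℤP.0≤i⇒+∣i∣≡i (ℤP.i≤j⇒0≤j-i (ℤP.≤-trans a≤x x≤b))))
    (ℤP.+-monoˡ-≤ (ℤ.- a) x≤b)))))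

∈-interval⁻ : ∀ {a b x} → a ℤ.≤ b → x ∈ interval a b → a ℤ.≤ x × x ℤ.≤ b
∈-interval⁻ {a} {b} a≤b x∈ with ∈-applyUpTo⁻ (λ t → a ℤ.+ + t) x∈
... | t , s≤s t≤ , refl = ℤP.i≤i+j a (+ t) , subst (a ℤ.+ + t ℤ.≤_) (+-∣-∣ a≤b) (ℤP.+-monoʳ-≤ a (ℤ.+≤+ t≤))

interval-unique : ∀ a b → Unique (interval a b)
interval-unique a b = UniqueP.applyUpTo⁺₁ (λ t → a ℤ.+ + t) _ λ {i} {j} i<j _ eq →
  ℕP.<⇒≢ i<j (ℤP.+-injective (ℤ-cancelˡ a (+ i) (+ j) eq))

∑-telescope : {A : Set} (F : ℕ → ℚ) (f : ℕ → A) (g : A → ℤ) → ∀ n →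
              (∀ {t} → t ℕ.< n → F (suc t) ≡ F t ℚ.+ ι (g (f t))) → F n ≡ F 0 ℚ.+ ι (∑ (applyUpTo f n) g)
∑-telescope F f g zero    Δ = sym (ℚP.+-identityʳ (F 0))
∑-telescope F f g (suc n) Δ = begin
  F (suc n)                                                   ≡⟨ ∑-telescope (F ∘ suc) (f ∘ suc) g n (Δ ∘ s≤s) ⟩
  F 1 ℚ.+ ι (∑ (applyUpTo (f ∘ suc) n) g)                     ≡⟨ cong (ℚ._+ _) (Δ (s≤s z≤n)) ⟩
  F 0 ℚ.+ ι (g (f 0)) ℚ.+ ι (∑ (applyUpTo (f ∘ suc) n) g)     ≡⟨ ℚP.+-assoc (F 0) _ _ ⟩
  F 0 ℚ.+ (ι (g (f 0)) ℚ.+ ι (∑ (applyUpTo (f ∘ suc) n) g))   ≡⟨ cong (F 0 ℚ.+_) (sym (ι-+ (g (f 0)) _)) ⟩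
  F 0 ℚ.+ ι (∑ (applyUpTo f (suc n)) g)                       ∎
  where open ≡-Reasoning

-- The sum telescopes along the values `F` of an antidifference. Agreement of `g` with `e` is asked
-- for on the interval only, since the polynomials below are correct only at weakly increasing
-- arguments.
⟦sumᴱ⟧ : {W : Set} (e : Expr (Maybe W)) (lo hi : W) (ρ : W → ℤ) (g : ℤ → ℤ) → ρ lo ℤ.≤ ρ hi →
         (∀ {x} → x ∈ interval (ρ lo) (ρ hi) → ι (g x) ≡ ⟦ e ⟧ (ι ∘ maybe′ ρ x)) →
         ι (∑ (interval (ρ lo) (ρ hi)) g) ≡ ⟦ sumᴱ e lo hi ⟧ (ι ∘ ρ)
⟦sumᴱ⟧ e lo hi ρ g lo≤hi eq = begin
  ι s                          ≡⟨ cancel (ι s) (H (ι (ρ lo))) ⟩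
  H (ι (ρ lo)) ℚ.+ ι s ℚ.+ ℚ.- 1ℚ ℚ.* H (ι (ρ lo))
    ≡⟨ cong (λ u → H (ι u) ℚ.+ ι s ℚ.+ ℚ.- 1ℚ ℚ.* H (ι (ρ lo))) (sym (ℤP.+-identityʳ (ρ lo))) ⟩
  F 0 ℚ.+ ι s ℚ.+ ℚ.- 1ℚ ℚ.* H (ι (ρ lo))
    ≡⟨ cong (ℚ._+ _) (sym (∑-telescope F (λ t → ρ lo ℤ.+ + t) g (suc d) Δ)) ⟩
  F (suc d) ℚ.+ ℚ.- 1ℚ ℚ.* H (ι (ρ lo))
    ≡⟨ cong (λ u → H u ℚ.+ ℚ.- 1ℚ ℚ.* H (ι (ρ lo))) (trans (step d) (cong (λ z → ι z ℚ.+ 1ℚ) (+-∣-∣ lo≤hi))) ⟩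
  H (ι (ρ hi) ℚ.+ 1ℚ) ℚ.+ ℚ.- 1ℚ ℚ.* H (ι (ρ lo))
    ≡⟨ sym (cong₂ (λ u v → u ℚ.+ ℚ.- 1ℚ ℚ.* v) (⟦antidifferenceᴱ⟧ 0 (coefficients e) (var hi ⊞ con 1ℚ) (ι ∘ ρ))
         (⟦antidifferenceᴱ⟧ 0 (coefficients e) (var lo) (ι ∘ ρ))) ⟩
  ⟦ sumᴱ e lo hi ⟧ (ι ∘ ρ)     ∎
  where
  open ≡-Reasoning
  d : ℕ
  d = ℤ.∣ ρ hi ℤ.- ρ lo ∣
  s : ℤ
  s = ∑ (interval (ρ lo) (ρ hi)) g
  H : ℚ → ℚ
  H = antidifference 0 (coefficients e) (ι ∘ ρ)
  F : ℕ → ℚ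
  F t = H (ι (ρ lo ℤ.+ + t))
  step : ∀ t → ι (ρ lo ℤ.+ + suc t) ≡ ι (ρ lo ℤ.+ + t) ℚ.+ 1ℚ
  step t = trans (cong ι (trans (cong (λ u → ρ lo ℤ.+ + u) (sym (ℕP.+-comm t 1)))
                                (sym (ℤP.+-assoc (ρ lo) (+ t) 1ℤ)))) (ι-+ (ρ lo ℤ.+ + t) 1ℤ)
  Δ : ∀ {t} → t ℕ.< suc d → F (suc t) ≡ F t ℚ.+ ι (g (ρ lo ℤ.+ + t))
  Δ {t} t<d = trans (cong H (step t)) (trans (antidifference-Δ 0 (coefficients e) (ι ∘ ρ) _)
    (cong (F t ℚ.+_) (trans (newton-coefficients (ι ∘ maybe′ ρ (ρ lo ℤ.+ + t)) e) (sym (eq (∈-applyUpTo⁺ (λ t → ρ lo ℤ.+ + t) t<d))))))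
  cancel : ∀ u h → u ≡ h ℚ.+ u ℚ.+ ℚ.- 1ℚ ℚ.* h
  cancel = solve 2 (λ u h → u := h :+ u :+ :con (ℚ.- 1ℚ) :* h) refl

-- Signed sums over boxes as polynomials

-- D k f is the signed sum of f over the boxes ∏ [k_j , k_{j+1}], one for each set of pairwise non-adjacent
-- constraints l_j = l_{j+1} (which force the value k_{j+1}).
D : ∀ {m} → Vec ℤ (suc m) → (Vec ℤ m → ℤ) → ℤ
D (_ ∷ [])            f = f []
D (k₁ ∷ k₂ ∷ [])      f = ∑ (interval k₁ k₂) (λ x → f (x ∷ []))
D (k₁ ∷ k₂ ∷ k₃ ∷ ks) f = ∑ (interval k₁ k₂) (λ x → D (k₂ ∷ k₃ ∷ ks) (λ l → f (x ∷ l)))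
                          ℤ.- D (k₃ ∷ ks) (λ l → f (k₂ ∷ k₂ ∷ l))

private
  -- The first summation variable becomes the parameter nothing.
  promote : ∀ {m} {W : Set} → Fin (suc m) ⊎ W → Fin m ⊎ Maybe W
  promote (inj₁ zero)    = inj₂ nothing
  promote (inj₁ (suc i)) = inj₁ i
  promote (inj₂ w)       = inj₂ (just w)

  merge : ∀ {m} {W : Set} → W → Fin (2 ℕ.+ m) ⊎ W → Fin m ⊎ W
  merge w (inj₁ zero)          = inj₂ w
  merge w (inj₁ (suc zero))    = inj₂ w
  merge w (inj₁ (suc (suc i))) = inj₁ i
  merge w (inj₂ v)             = inj₂ v

  forget : {W : Set} → Fin 0 ⊎ W → W
  forget (inj₂ w) = w

-- `D` on expressions: `κ` names the parameters that hold the entries of k, and `Fin m` indexes the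
-- variables still to be summed over.
Dᴱ : ∀ {m} {W : Set} → Vec W (suc m) → Expr (Fin m ⊎ W) → Expr W
Dᴱ (_ ∷ [])            e = rename forget e
Dᴱ (κ₁ ∷ κ₂ ∷ [])      e = sumᴱ (rename (forget ∘ promote) e) κ₁ κ₂
Dᴱ (κ₁ ∷ κ₂ ∷ κ₃ ∷ κs) e = sumᴱ (Dᴱ (Vec.map just (κ₂ ∷ κ₃ ∷ κs)) (rename promote e)) κ₁ κ₂
                           ⊞ (con (ℚ.- 1ℚ) ⊠ Dᴱ (κ₃ ∷ κs) (rename (merge κ₂) e))

env : ∀ {m} {W : Set} → Vec ℤ m → (W → ℤ) → Fin m ⊎ W → ℚ
env l ρ = [ ι ∘ lookup l , ι ∘ ρ ]′

lower : ∀ {m} {x y : ℤ} {l : Vec ℤ m} → x ℤ.≤ y → Linked ℤ._≤_ (y ∷ l) → Linked ℤ._≤_ (x ∷ l)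
lower x≤y [-]       = [-]
lower x≤y (y≤z ∷ r) = ℤP.≤-trans x≤y y≤z ∷ r

-- For weakly increasing `k`, `D` evaluates `f` only at weakly increasing vectors starting at or
-- above the first entry of `k`; the hypothesis on `e` covers exactly such vectors.
⟦Dᴱ⟧ : ∀ {m} {W : Set} (κ : Vec W (suc m)) (e : Expr (Fin m ⊎ W)) (ρ : W → ℤ) {k : Vec ℤ (suc m)} (f : Vec ℤ m → ℤ) →
       Pointwise (λ w x → ρ w ≡ x) κ k → Linked ℤ._≤_ k →
       (∀ l → Linked ℤ._≤_ (Vec.head k ∷ l) → ι (f l) ≡ ⟦ e ⟧ (env l ρ)) →
       ι (D k f) ≡ ⟦ Dᴱ κ e ⟧ (ι ∘ ρ)
⟦Dᴱ⟧ (_ ∷ []) e ρ f (_ ∷ []) _ eq = trans (eq [] [-]) (sym (⟦rename⟧ forget e λ { (inj₂ _) → refl }))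
⟦Dᴱ⟧ (κ₁ ∷ κ₂ ∷ []) e ρ f (refl ∷ refl ∷ []) (k₁≤k₂ ∷ [-]) eq =
  ⟦sumᴱ⟧ (rename (forget ∘ promote) e) κ₁ κ₂ ρ (λ x → f (x ∷ [])) k₁≤k₂ λ x∈ →
    trans (eq _ (proj₁ (∈-interval⁻ k₁≤k₂ x∈) ∷ [-]))
          (sym (⟦rename⟧ (forget ∘ promote) e λ { (inj₁ zero) → refl ; (inj₂ _) → refl }))
⟦Dᴱ⟧ (κ₁ ∷ κ₂ ∷ κ₃ ∷ κs) e ρ {k₁ ∷ k₂ ∷ k₃ ∷ ks} f (refl ∷ refl ∷ refl ∷ pw) (k₁≤k₂ ∷ inc@(k₂≤k₃ ∷ inc′)) eq =
  begin
  ι (∑ (interval k₁ k₂) (λ x → D (k₂ ∷ k₃ ∷ ks) (λ l → f (x ∷ l))) ℤ.- D (k₃ ∷ ks) (λ l → f (k₂ ∷ k₂ ∷ l)))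
    ≡⟨ ι-- (∑ (interval k₁ k₂) λ x → D (k₂ ∷ k₃ ∷ ks) (λ l → f (x ∷ l))) _ ⟩
  ι (∑ (interval k₁ k₂) (λ x → D (k₂ ∷ k₃ ∷ ks) (λ l → f (x ∷ l)))) ℚ.- ι (D (k₃ ∷ ks) (λ l → f (k₂ ∷ k₂ ∷ l)))
    ≡⟨ cong₂ ℚ._-_
         (⟦sumᴱ⟧ (Dᴱ (Vec.map just (κ₂ ∷ κ₃ ∷ κs)) (rename promote e)) κ₁ κ₂ ρ
           (λ x → D (k₂ ∷ k₃ ∷ ks) (λ l → f (x ∷ l))) k₁≤k₂ λ {x} x∈ →
           ⟦Dᴱ⟧ (Vec.map just (κ₂ ∷ κ₃ ∷ κs)) (rename promote e) (maybe′ ρ x) (λ l → f (x ∷ l))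
             (refl ∷ refl ∷ shift x pw) inc (promoted x∈))
         (⟦Dᴱ⟧ (κ₃ ∷ κs) (rename (merge κ₂) e) ρ (λ l → f (k₂ ∷ k₂ ∷ l)) (refl ∷ pw) inc′ merged) ⟩
  summed-value ℚ.- merged-value
    ≡⟨ cong (summed-value ℚ.+_) (neg-mult merged-value) ⟩
  ⟦ Dᴱ (κ₁ ∷ κ₂ ∷ κ₃ ∷ κs) e ⟧ (ι ∘ ρ) ∎
  where
  open ≡-Reasoning
  summed-value merged-value : ℚ
  summed-value = ⟦ sumᴱ (Dᴱ (Vec.map just (κ₂ ∷ κ₃ ∷ κs)) (rename promote e)) κ₁ κ₂ ⟧ (ι ∘ ρ)
  merged-value = ⟦ Dᴱ (κ₃ ∷ κs) (rename (merge κ₂) e) ⟧ (ι ∘ ρ)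
  merged : ∀ l → Linked ℤ._≤_ (k₃ ∷ l) → ι (f (k₂ ∷ k₂ ∷ l)) ≡ ⟦ rename (merge κ₂) e ⟧ (env l ρ)
  merged l inc″ = trans (eq (k₂ ∷ k₂ ∷ l) (k₁≤k₂ ∷ ℤP.≤-refl ∷ lower k₂≤k₃ inc″))
    (sym (⟦rename⟧ (merge κ₂) e λ { (inj₁ zero) → refl ; (inj₁ (suc zero)) → refl
                                  ; (inj₁ (suc (suc _))) → refl ; (inj₂ _) → refl }))
  promoted : ∀ {x} → x ∈ interval k₁ k₂ → ∀ l → Linked ℤ._≤_ (k₂ ∷ l) →
             ι (f (x ∷ l)) ≡ ⟦ rename promote e ⟧ (env l (maybe′ ρ x))
  promoted {x} x∈ l inc″ = let k₁≤x , x≤k₂ = ∈-interval⁻ k₁≤k₂ x∈ in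
    trans (eq (x ∷ l) (k₁≤x ∷ lower x≤k₂ inc″))
      (sym (⟦rename⟧ promote e λ { (inj₁ zero) → refl ; (inj₁ (suc _)) → refl ; (inj₂ _) → refl }))
  shift : ∀ x {n} {κ : Vec _ n} {k : Vec ℤ n} → Pointwise (λ w y → ρ w ≡ y) κ k →
          Pointwise (λ w y → maybe′ ρ x w ≡ y) (Vec.map just κ) k
  shift x []       = []
  shift x (p ∷ ps) = p ∷ shift x ps
  neg-mult : ∀ v → ℚ.- v ≡ ℚ.- 1ℚ ℚ.* v
  neg-mult = solve 1 (λ v → :- v := :con (ℚ.- 1ℚ) :* v) refl

-- Strictly interlacing rows

box : ∀ {m} → Vec ℤ (suc m) → List (Vec ℤ m)
box (_ ∷ [])       = [] ∷ []
box (k₁ ∷ k₂ ∷ ks) = cartesianProductWith _∷_ (interval k₁ k₂) (box (k₂ ∷ ks))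

box-∷⁻ : ∀ {m} k₁ k₂ (ks : Vec ℤ m) {x l} → x ∷ l ∈ box (k₁ ∷ k₂ ∷ ks) → x ∈ interval k₁ k₂ × l ∈ box (k₂ ∷ ks)
box-∷⁻ k₁ k₂ ks p with ∈-cartesianProductWith⁻ _∷_ (interval k₁ k₂) (box (k₂ ∷ ks)) p
... | _ , _ , x∈ , l∈ , refl = x∈ , l∈

box-unique : ∀ {m} (k : Vec ℤ (suc m)) → Unique (box k)
box-unique (_ ∷ [])       = [] ∷ []
box-unique (k₁ ∷ k₂ ∷ ks) =
  UniqueP.cartesianProductWith⁺ _∷_ VecP.∷-injective (interval-unique k₁ k₂) (box-unique (k₂ ∷ ks))

strict? : ∀ {m} (l : Vec ℤ m) → Dec (Linked ℤ._<_ l)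
strict? = linked? ℤ._<?_

data Triple : ∀ {n} → Vec ℤ n → Set where
  here  : ∀ {n x} {l : Vec ℤ n} → Triple (x ∷ x ∷ x ∷ l)
  there : ∀ {n x} {l : Vec ℤ n} → Triple l → Triple (x ∷ l)

∈-interval-self : ∀ x {y} → y ∈ interval x x → y ≡ x
∈-interval-self x y∈ = let x≤y , y≤x = ∈-interval⁻ ℤP.≤-refl y∈ in ℤP.≤-antisym y≤x x≤y

-- Three equal entries give two consecutive one-point intervals, which force two equal neighbours in
-- `l`.
box-triple : ∀ {m} {k : Vec ℤ (suc m)} {l} → Triple k → l ∈ box k → ¬ Linked ℤ._<_ l
box-triple {k = x ∷ _ ∷ _ ∷ ks} {_ ∷ _ ∷ _} here l∈ (y<z ∷ _)
  with y∈ , l′∈ ← box-∷⁻ x x (x ∷ ks) l∈ with z∈ , _ ← box-∷⁻ x x ks l′∈ =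
  ℤP.<-irrefl (trans (∈-interval-self x y∈) (sym (∈-interval-self x z∈))) y<z
box-triple {k = k₁ ∷ k₂ ∷ ks} {_ ∷ _} (there t) l∈ str = box-triple t (proj₂ (box-∷⁻ k₁ k₂ ks l∈)) (Linked.tail str)

[]·-strict-∷ : ∀ {m x y} {l : Vec ℤ m} → x ℤ.< y → ∀ z → [ strict? (y ∷ l) ]· z ≡ [ strict? (x ∷ y ∷ l) ]· z
[]·-strict-∷ {x = x} {y} {l} x<y = []·-⇔ (strict? (y ∷ l)) (strict? (x ∷ y ∷ l)) (x<y ∷_) Linked.tail

∑-box-∷ : ∀ {m} k₁ k₂ (ks : Vec ℤ m) (f : Vec ℤ (suc m) → ℤ) →
          ∑ (box (k₁ ∷ k₂ ∷ ks)) f ≡ ∑ (interval k₁ k₂) (λ x → ∑ (box (k₂ ∷ ks)) (λ l → f (x ∷ l)))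
∑-box-∷ k₁ k₂ ks f = ∑-× _∷_ (interval k₁ k₂) (box (k₂ ∷ ks)) f

strictly : ∀ {m} → (Vec ℤ m → ℤ) → Vec ℤ m → ℤ
strictly f l = [ strict? l ]· f l

-- Dropping the condition x < l₁ from the strict sum adds exactly the terms with x = l₁ = k₂; among those,
-- the ones with l₂ = k₂ too vanish because f does on triples.
strict-recursion : ∀ {m} k₁ k₂ k₃ (ks : Vec ℤ m) (f : Vec ℤ (2 ℕ.+ m) → ℤ) → k₁ ℤ.≤ k₂ → Linked ℤ._≤_ (k₂ ∷ k₃ ∷ ks) →
  (∀ l → Triple l → f l ≡ 0ℤ) →
  ∑ (interval k₁ k₂) (λ x → ∑ (box (k₂ ∷ k₃ ∷ ks)) (strictly λ l → f (x ∷ l))) ≡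
  ∑ (box (k₁ ∷ k₂ ∷ k₃ ∷ ks)) (strictly f) + ∑ (box (k₃ ∷ ks)) (strictly λ l → f (k₂ ∷ k₂ ∷ l))
strict-recursion k₁ k₂ k₃ ks f k₁≤k₂ (k₂≤k₃ ∷ inc) f-triple =
  trans (∑-extract (interval-unique k₁ k₂) (∈-interval⁺ k₁≤k₂ ℤP.≤-refl) below at)
        (cong (λ s → s + C) (sym (∑-box-∷ k₁ k₂ (k₃ ∷ ks) (strictly f))))
  where
  C : ℤ
  C = ∑ (box (k₃ ∷ ks)) (strictly λ l → f (k₂ ∷ k₂ ∷ l))
  -- For x < k₂ the condition x < l₁ is automatic, as l₁ ≥ k₂.
  below : ∀ {x} → x ∈ interval k₁ k₂ → x ≢ k₂ →
          ∑ (box (k₂ ∷ k₃ ∷ ks)) (strictly λ l → f (x ∷ l)) ≡ ∑ (box (k₂ ∷ k₃ ∷ ks)) (λ l → strictly f (x ∷ l))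
  below {x} x∈ x≢k₂ = ∑-cong (box (k₂ ∷ k₃ ∷ ks)) λ { {y ∷ l} l∈ →
    []·-strict-∷ {l = l} (ℤP.<-≤-trans (ℤP.≤∧≢⇒< (proj₂ (∈-interval⁻ k₁≤k₂ x∈)) x≢k₂)
                                       (proj₁ (∈-interval⁻ k₂≤k₃ (proj₁ (box-∷⁻ k₂ k₃ ks l∈))))) _ }
  tail-strict : ∀ {m} {ks : Vec ℤ m} {f : Vec ℤ (2 ℕ.+ m) → ℤ} → Linked ℤ._≤_ (k₃ ∷ ks) → (∀ l → Triple l → f l ≡ 0ℤ) →
         ∀ {l} → l ∈ box (k₃ ∷ ks) → strictly (λ l → f (k₂ ∷ l)) (k₂ ∷ l) ≡ strictly (λ l → f (k₂ ∷ k₂ ∷ l)) l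
  tail-strict _ _ {[]} _ = refl
  tail-strict {ks = k₄ ∷ ks} (k₃≤k₄ ∷ _) f-triple {z ∷ l} l∈ with k₂ ℤ.≟ z
  ... | no k₂≢z  = sym ([]·-strict-∷ {l = l} (ℤP.≤∧≢⇒< (ℤP.≤-trans k₂≤k₃ (proj₁ (∈-interval⁻ k₃≤k₄ (proj₁ (box-∷⁻ k₃ k₄ ks l∈))))) k₂≢z) _)
  ... | yes refl = trans (cong ([ strict? (k₂ ∷ k₂ ∷ l) ]·_) (f-triple _ here)) (trans ([]·-zero (strict? (k₂ ∷ k₂ ∷ l)))
                     (sym (trans (cong ([ strict? (k₂ ∷ l) ]·_) (f-triple _ here)) ([]·-zero (strict? (k₂ ∷ l))))))
  -- At x = k₂ the two sides differ only in the terms with l₁ = k₂: these are excluded on the right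
  -- and add up to `C` on the left.
  at : ∑ (box (k₂ ∷ k₃ ∷ ks)) (strictly λ l → f (k₂ ∷ l)) ≡ ∑ (box (k₂ ∷ k₃ ∷ ks)) (λ l → strictly f (k₂ ∷ l)) + C
  at = trans (∑-box-∷ k₂ k₃ ks _) (trans
    (∑-extract (interval-unique k₂ k₃) (∈-interval⁺ ℤP.≤-refl k₂≤k₃)
      (λ y∈ y≢k₂ → ∑-cong (box (k₃ ∷ ks)) λ {l} _ →
        []·-strict-∷ {l = l} (ℤP.≤∧≢⇒< (proj₁ (∈-interval⁻ k₂≤k₃ y∈)) (y≢k₂ ∘ sym)) _)
      (trans (∑-cong (box (k₃ ∷ ks)) (tail-strict inc f-triple))
        (sym (trans (cong (λ s → s + C) (∑-zero (box (k₃ ∷ ks)) λ {l} _ →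
                []·-no (strict? (k₂ ∷ k₂ ∷ l)) (λ { (lt ∷ _) → ℤP.<-irrefl refl lt }) _))
              (ℤP.+-identityˡ C)))))
    (cong (λ s → s + C) (sym (∑-box-∷ k₂ k₃ ks (λ l → strictly f (k₂ ∷ l))))))

-- The subtracted term of `D` is precisely the surplus found in `strict-recursion`. Vanishing on
-- triples is inherited when leading arguments of `f` are fixed.
D-strict : ∀ {m} (k : Vec ℤ (suc m)) (f : Vec ℤ m → ℤ) → Linked ℤ._≤_ k → (∀ l → Triple l → f l ≡ 0ℤ) →
           D k f ≡ ∑ (box k) (strictly f)
D-strict (_ ∷ [])            f _   _ = sym (ℤP.+-identityʳ (f []))
D-strict (k₁ ∷ k₂ ∷ [])      f _   _ = sym (trans (∑-box-∷ k₁ k₂ [] (strictly f))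
  (∑-cong (interval k₁ k₂) λ {x} _ → ℤP.+-identityʳ (f (x ∷ []))))
D-strict (k₁ ∷ k₂ ∷ k₃ ∷ ks) f (k₁≤k₂ ∷ inc@(_ ∷ inc′)) f-triple = begin
  ∑ (interval k₁ k₂) (λ x → D (k₂ ∷ k₃ ∷ ks) (λ l → f (x ∷ l))) - D (k₃ ∷ ks) (λ l → f (k₂ ∷ k₂ ∷ l))
    ≡⟨ cong₂ _-_
         (∑-cong (interval k₁ k₂) λ {x} _ → D-strict (k₂ ∷ k₃ ∷ ks) (λ l → f (x ∷ l)) inc (λ l t → f-triple (x ∷ l) (there t)))
         (D-strict (k₃ ∷ ks) (λ l → f (k₂ ∷ k₂ ∷ l)) inc′ (λ l t → f-triple (k₂ ∷ k₂ ∷ l) (there (there t)))) ⟩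
  ∑ (interval k₁ k₂) (λ x → ∑ (box (k₂ ∷ k₃ ∷ ks)) (strictly λ l → f (x ∷ l))) - C
    ≡⟨ cong (λ s → s - C) (strict-recursion k₁ k₂ k₃ ks f k₁≤k₂ inc f-triple) ⟩
  B + C - C     ≡⟨ ℤP.+-assoc B C (- C) ⟩
  B + (C - C)   ≡⟨ cong (λ s → B + s) (ℤP.+-inverseʳ C) ⟩
  B + 0ℤ        ≡⟨ ℤP.+-identityʳ B ⟩
  B             ∎
  where
  open ≡-Reasoning
  B C : ℤ
  B = ∑ (box (k₁ ∷ k₂ ∷ k₃ ∷ ks)) (strictly f)
  C = ∑ (box (k₃ ∷ ks)) (strictly λ l → f (k₂ ∷ k₂ ∷ l))

-- Adding and removing a bottom row

-- k_j, with the 1-based indexing of arrays and junk value 0 outside 1 ≤ j ≤ n.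
entry : ∀ {n} → Vec ℤ n → ℕ → ℤ
entry (x ∷ v) (suc zero)    = x
entry (x ∷ v) (suc (suc j)) = entry v (suc j)
entry _       _             = 0ℤ

entry-lookup : ∀ {n} (v : Vec ℤ n) j → entry v (suc (toℕ j)) ≡ lookup v j
entry-lookup (x ∷ v) zero    = refl
entry-lookup (x ∷ v) (suc j) = entry-lookup v j

BottomRow⇒entry : ∀ {n} k a → BottomRow n k a → ∀ {j} → 1 ℕ.≤ j → j ℕ.≤ n → a n j ≡ entry k j
BottomRow⇒entry {n} k a bottom {suc j} _ j<n =
  subst (λ t → a n (suc t) ≡ entry k (suc t)) (FinP.toℕ-fromℕ< j<n)
    (trans (bottom (fromℕ< j<n)) (sym (entry-lookup k (fromℕ< j<n))))

Interlaces : ∀ {m} → Vec ℤ (suc m) → Vec ℤ m → Set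
Interlaces {m} k l = ∀ j → 1 ℕ.≤ j → j ℕ.≤ m → entry k j ℤ.≤ entry l j × entry l j ℤ.≤ entry k (suc j)

∈-box⁻ : ∀ {m} {k : Vec ℤ (suc m)} {l} → Linked ℤ._≤_ k → l ∈ box k → Interlaces k l
∈-box⁻ {k = _ ∷ []} {[]} _ _ zero    () _
∈-box⁻ {k = _ ∷ []} {[]} _ _ (suc j) _  ()
∈-box⁻ {k = k₁ ∷ k₂ ∷ ks} {x ∷ l} (k₁≤k₂ ∷ _) l∈ (suc zero) _ _ = ∈-interval⁻ k₁≤k₂ (proj₁ (box-∷⁻ k₁ k₂ ks l∈))
∈-box⁻ {k = k₁ ∷ k₂ ∷ ks} {x ∷ l} (_ ∷ inc) l∈ (suc (suc j)) _ (s≤s j≤m) =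
  ∈-box⁻ inc (proj₂ (box-∷⁻ k₁ k₂ ks l∈)) (suc j) (s≤s z≤n) j≤m

∈-box⁺ : ∀ {m} {k : Vec ℤ (suc m)} {l} → Interlaces k l → l ∈ box k
∈-box⁺ {k = _ ∷ []} {[]} _ = here refl
∈-box⁺ {k = k₁ ∷ k₂ ∷ ks} {x ∷ l} il = let k₁≤x , x≤k₂ = il 1 (s≤s z≤n) (s≤s z≤n) in
  ∈-cartesianProductWith⁺ _∷_ (∈-interval⁺ k₁≤x x≤k₂)
    (∈-box⁺ {k = k₂ ∷ ks} λ { (suc j) _ j≤m → il (suc (suc j)) (s≤s z≤n) (s≤s j≤m) })

Linked<⇒entry : ∀ {m} {l : Vec ℤ m} → Linked ℤ._<_ l → ∀ {j} → 1 ℕ.≤ j → j ℕ.< m → entry l j ℤ.< entry l (suc j)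
Linked<⇒entry {l = _ ∷ _ ∷ _} (lt ∷ _)   {suc zero}    _ _         = lt
Linked<⇒entry {l = _ ∷ _ ∷ _} (_ ∷ str) {suc (suc j)} _ (s≤s j<m) = Linked<⇒entry str (s≤s z≤n) j<m
Linked<⇒entry {l = _ ∷ []}    _          {suc zero}    _ (s≤s ())

entry⇒Linked< : ∀ {m} {l : Vec ℤ m} → (∀ {j} → 1 ℕ.≤ j → j ℕ.< m → entry l j ℤ.< entry l (suc j)) → Linked ℤ._<_ l
entry⇒Linked< {l = []}        _  = []
entry⇒Linked< {l = _ ∷ []}    _  = [-]
entry⇒Linked< {l = _ ∷ _ ∷ _} lt = lt {1} (s≤s z≤n) (s≤s (s≤s z≤n)) ∷
  entry⇒Linked< λ { {suc j} _ j<m → lt {suc (suc j)} (s≤s z≤n) (s≤s j<m) }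

extend : ∀ {n} → Vec ℤ n → Arr → Arr
extend {n} k a i j = if does (i ℕ.≟ n) then entry k j else a i j

module _ {m} (k : Vec ℤ (suc m)) (a : Arr) where

  extend-bottom : ∀ j → extend k a (suc m) j ≡ entry k j
  extend-bottom j = cong (λ b → if b then entry k j else a (suc m) j) (dec-true (suc m ℕ.≟ suc m) refl)

  extend-above : ∀ {i j} → i ℕ.≤ m → extend k a i j ≡ a i j
  extend-above {i} {j} i≤m = cong (λ b → if b then entry k j else a i j)
    (dec-false (i ℕ.≟ suc m) (ℕP.<⇒≢ (s≤s i≤m)))

  -- The new inequalities between rows m and m + 1 are the interlacing. Row m is no longer the
  -- bottom row, so its strictness now has to come from `l`.
  extend-monotone : ∀ {l} → Interlaces k l → Linked ℤ._<_ l → MonotoneTriangle m l a →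
                    MonotoneTriangle (suc m) k (extend k a)
  extend-monotone {l} il str (bottom , vert , diag , strict) =
    (λ j → trans (extend-bottom (suc (toℕ j))) (entry-lookup k j)) , vert′ , diag′ , strict′
    where
    row : ∀ {j} → 1 ℕ.≤ j → j ℕ.≤ m → extend k a m j ≡ entry l j
    row 1≤j j≤m = trans (extend-above ℕP.≤-refl) (BottomRow⇒entry l a bottom 1≤j j≤m)
    vert′ : ∀ i j → 1 ℕ.≤ j → j ℕ.< i → i ℕ.≤ suc m → extend k a i j ℤ.≤ extend k a (i ∸ 1) j
    vert′ i j 1≤j j<i i≤sm with ℕP.m≤n⇒m<n∨m≡n i≤sm
    ... | inj₁ (s≤s i≤m) = subst₂ ℤ._≤_ (sym (extend-above i≤m)) (sym (extend-above (ℕP.≤-trans (ℕP.m∸n≤m i 1) i≤m)))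
                             (vert i j 1≤j j<i i≤m)
    vert′ _ j 1≤j (s≤s j≤m) _ | inj₂ refl = subst₂ ℤ._≤_ (sym (extend-bottom j)) (sym (row 1≤j j≤m)) (proj₁ (il j 1≤j j≤m))
    diag′ : ∀ i j → 1 ℕ.≤ j → j ℕ.≤ i → i ℕ.< suc m → extend k a i j ℤ.≤ extend k a (suc i) (suc j)
    diag′ i j 1≤j j≤i (s≤s i≤m) with ℕP.m≤n⇒m<n∨m≡n i≤m
    ... | inj₁ i<m  = subst₂ ℤ._≤_ (sym (extend-above i≤m)) (sym (extend-above i<m)) (diag i j 1≤j j≤i i<m)
    ... | inj₂ refl = subst₂ ℤ._≤_ (sym (row 1≤j j≤i)) (sym (extend-bottom (suc j))) (proj₂ (il j 1≤j j≤i))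
    strict′ : ∀ i j → 1 ℕ.≤ j → j ℕ.< i → i ℕ.< suc m → extend k a i j ℤ.< extend k a i (suc j)
    strict′ i j 1≤j j<i (s≤s i≤m) with ℕP.m≤n⇒m<n∨m≡n i≤m
    ... | inj₁ i<m  = subst₂ ℤ._<_ (sym (extend-above i≤m)) (sym (extend-above i≤m)) (strict i j 1≤j j<i i<m)
    ... | inj₂ refl = subst₂ ℤ._<_ (sym (row 1≤j (ℕP.<⇒≤ j<i))) (sym (row (s≤s z≤n) j<i)) (Linked<⇒entry str 1≤j j<i)

rowVec : Arr → (m : ℕ) → Vec ℤ m
rowVec a m = tabulate λ j → a m (suc (toℕ j))

rowVec-bottom : ∀ a m → BottomRow m (rowVec a m) a
rowVec-bottom a m j = sym (VecP.lookup∘tabulate (λ j → a m (suc (toℕ j))) j)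

module _ {m} (k : Vec ℤ (suc m)) (a : Arr) (mt : MonotoneTriangle (suc m) k a) where

  private
    bottom = proj₁ mt
    vert   = proj₁ (proj₂ mt)
    diag   = proj₁ (proj₂ (proj₂ mt))
    strict = proj₂ (proj₂ (proj₂ mt))

    row : ∀ {j} → 1 ℕ.≤ j → j ℕ.≤ m → a m j ≡ entry (rowVec a m) j
    row = BottomRow⇒entry (rowVec a m) a (rowVec-bottom a m)

  truncate : MonotoneTriangle m (rowVec a m) a
  truncate = rowVec-bottom a m ,
    (λ i j 1≤j j<i i≤m → vert i j 1≤j j<i (ℕP.m≤n⇒m≤1+n i≤m)) ,
    (λ i j 1≤j j≤i i<m → diag i j 1≤j j≤i (ℕP.m≤n⇒m≤1+n i<m)) ,
    (λ i j 1≤j j<i i<m → strict i j 1≤j j<i (ℕP.m≤n⇒m≤1+n i<m))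

  row-interlaces : Interlaces k (rowVec a m)
  row-interlaces j 1≤j j≤m =
    subst₂ ℤ._≤_ (BottomRow⇒entry k a bottom 1≤j (ℕP.m≤n⇒m≤1+n j≤m)) (row 1≤j j≤m)
      (vert (suc m) j 1≤j (s≤s j≤m) ℕP.≤-refl) ,
    subst₂ ℤ._≤_ (row 1≤j j≤m) (BottomRow⇒entry k a bottom (s≤s z≤n) (s≤s j≤m))
      (diag m j 1≤j j≤m ℕP.≤-refl)

  row-strict : Linked ℤ._<_ (rowVec a m)
  row-strict = entry⇒Linked< λ 1≤j j<m →
    subst₂ ℤ._<_ (row 1≤j (ℕP.<⇒≤ j<m)) (row (s≤s z≤n) j<m) (strict m _ 1≤j j<m ℕP.≤-refl)

-- Enumeration of monotone triangles

strictBox : ∀ {m} → Vec ℤ (suc m) → List (Vec ℤ m)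
strictBox k = filter strict? (box k)

triangles : ∀ n → Vec ℤ n → List Arr
-- GT_0 has no points, so all arrays are identified and one representative suffices.
triangles zero    _ = (λ _ _ → 0ℤ) ∷ []
triangles (suc m) k = concatMap (λ l → map (extend k) (triangles m l)) (strictBox k)

triangles-sound : ∀ n {k} → Linked ℤ._≤_ k → All (MonotoneTriangle n k) (triangles n k)
triangles-sound zero    _   = ((λ ()) , (λ { _ _ (s≤s _) () z≤n }) , (λ _ _ _ _ ()) , (λ _ _ _ _ ())) ∷ []
triangles-sound (suc m) {k} inc = AllP.concat⁺ (AllP.map⁺ (All.tabulate λ l∈ →
  let l∈box , str = ∈-filter⁻ strict? {xs = box k} l∈ in
  AllP.map⁺ (All.map (λ {a} → extend-monotone k a (∈-box⁻ inc l∈box) str)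
                     (triangles-sound m (Linked.map ℤP.<⇒≤ str)))))

triangles-complete : ∀ n {k a} → MonotoneTriangle n k a → Any (a ≈[ n ]_) (triangles n k)
triangles-complete zero    _  = here λ { i j (1≤j , j≤i , z≤n) → contradiction (ℕP.≤-trans 1≤j j≤i) λ () }
triangles-complete (suc m) {k} {a} mt = AnyP.concatMap⁺ (λ l → map (extend k) (triangles m l))
  (lose (∈-filter⁺ strict? (∈-box⁺ {k = k} (row-interlaces k a mt)) (row-strict k a mt))
    (AnyP.map⁺ (Any.map agree (triangles-complete m (truncate k a mt)))))
  where
  agree : ∀ {b} → a ≈[ m ] b → a ≈[ suc m ] extend k b
  agree {b} a≈b i j (1≤j , j≤i , i≤sm) with ℕP.m≤n⇒m<n∨m≡n i≤sm
  ... | inj₁ (s≤s i≤m) = trans (a≈b i j (1≤j , j≤i , i≤m)) (sym (extend-above k b i≤m))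
  ... | inj₂ refl      = trans (BottomRow⇒entry k a (proj₁ mt) 1≤j j≤i) (sym (extend-bottom k b j))

-- Recovers the row `l` from a triangle in the proof of distinctness, where `k` is arbitrary.
triangles-bottom : ∀ n k → All (BottomRow n k) (triangles n k)
triangles-bottom zero    k = (λ ()) ∷ []
triangles-bottom (suc m) k = AllP.concat⁺ (AllP.map⁺ {xs = strictBox k} (All.tabulate λ {l} _ →
  AllP.map⁺ {xs = triangles m l} (All.tabulate λ {a} _ j → trans (extend-bottom k a (suc (toℕ j))) (entry-lookup k j))))

-- Triangles built over the same row `l` already differ in their first m rows; those built over
-- different rows differ in row m.
triangles-distinct : ∀ n k → AllPairs (λ a b → ¬ (a ≈[ n ] b)) (triangles n k)
triangles-distinct zero    k = [] ∷ []
triangles-distinct (suc m) k = AllPairsP.concat⁺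
  (AllP.map⁺ (All.tabulate λ {l} _ → AllPairsP.map⁺ (AllPairs.map (λ a≉b ea≈eb → a≉b (restrict ea≈eb)) (triangles-distinct m l))))
  (AllPairsP.map⁺ (AllPairs.map (λ {l} {l′} l≢l′ → AllP.map⁺ (All.map (λ bot → AllP.map⁺ (All.map (λ bot′ ea≈eb →
      l≢l′ (Ext.Pointwise-≡⇒≡ (Ext.ext λ j → trans (sym (bot j)) (trans
        (restrict ea≈eb m (suc (toℕ j)) (s≤s z≤n , FinP.toℕ<n j , ℕP.≤-refl)) (bot′ j)))))
      (triangles-bottom m l′))) (triangles-bottom m l)))
    (UniqueP.filter⁺ strict? (box-unique k))))
  where
  restrict : ∀ {a b} → extend k a ≈[ suc m ] extend k b → a ≈[ m ] b
  restrict {a} {b} ea≈eb i j (1≤j , j≤i , i≤m) = trans (sym (extend-above k a i≤m))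
    (trans (ea≈eb i j (1≤j , j≤i , ℕP.m≤n⇒m≤1+n i≤m)) (extend-above k b i≤m))

α# : ∀ n → Vec ℤ n → ℕ
α# n k = length (triangles n k)

α#-Count : ∀ n {k} → Linked ℤ._≤_ k → Count n (MonotoneTriangle n k) (α# n k)
α#-Count n {k} inc = record
  { elems    = triangles n k
  ; size     = refl
  ; sound    = triangles-sound n inc
  ; complete = λ _ → triangles-complete n
  ; distinct = triangles-distinct n k
  }

-- Recursion and polynomiality of the number of triangles

length-concatMap-∑ : {A B : Set} (f : A → List B) (xs : List A) → + length (concatMap f xs) ≡ ∑ xs (λ x → + length (f x))
length-concatMap-∑ f []       = refl
length-concatMap-∑ f (x ∷ xs) = trans (cong +_ (length-++ (f x))) (cong (λ s → + length (f x) + s) (length-concatMap-∑ f xs))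

α#-recursion : ∀ m k → + α# (suc m) k ≡ ∑ (box k) (strictly λ l → + α# m l)
α#-recursion m k = begin
  + α# (suc m) k
    ≡⟨ length-concatMap-∑ (λ l → map (extend k) (triangles m l)) (strictBox k) ⟩
  ∑ (strictBox k) (λ l → + length (map (extend k) (triangles m l)))
    ≡⟨ ∑-cong (strictBox k) (λ {l} _ → cong +_ (length-map (extend k) (triangles m l))) ⟩
  ∑ (strictBox k) (λ l → + α# m l)
    ≡⟨ ∑-filter strict? (box k) (λ l → + α# m l) ⟩
  ∑ (box k) (strictly λ l → + α# m l) ∎
  where open ≡-Reasoning

α#-triple : ∀ {n} (k : Vec ℤ n) → Triple k → + α# n k ≡ 0ℤ
α#-triple {suc m} k t = trans (α#-recursion m k) (∑-zero (box k) λ {l} l∈ → []·-no (strict? l) (box-triple t l∈) _)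

-- Vanishing on triples turns the strict sum of the recursion into `D`, and `Dᴱ` carries the
-- polynomial for m over to m + 1.
α#-polynomial : ∀ n → Σ (Expr (Fin n)) λ e → ∀ k → Linked ℤ._≤_ k → ι (+ α# n k) ≡ ⟦ e ⟧ (ι ∘ lookup k)
α#-polynomial zero    = con 1ℚ , λ _ _ → refl
-- The parameters are the m + 1 entries of `k`, named by `allFin`; `inj₁` marks every variable of
-- `e` as one to be summed over.
α#-polynomial (suc m) with e , eq ← α#-polynomial m = Dᴱ (Vec.allFin (suc m)) (rename inj₁ e) , λ k inc →
  trans (cong ι (trans (α#-recursion m k) (sym (D-strict k (λ l → + α# m l) inc α#-triple))))
    (⟦Dᴱ⟧ (Vec.allFin (suc m)) (rename inj₁ e) (lookup k) (λ l → + α# m l) (allFin-lookup k) inc λ l inc′ →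
      trans (eq l (Linked.tail inc′)) (sym (⟦rename⟧ inj₁ e λ _ → refl)))
  where
  allFin-lookup : ∀ {n} (k : Vec ℤ n) → Pointwise (λ i x → lookup k i ≡ x) (Vec.allFin n) k
  allFin-lookup k = subst (Pointwise _ (Vec.allFin _)) (VecP.tabulate∘lookup k) (Pointwise.tabulate⁺ λ _ → refl)

-- Passage to `Poly`, `WeaklyIncreasing` and positions in `Fin n`

toPoly : ∀ {n} → Expr (Fin n) → Poly n
toPoly (con q) = con q
toPoly (var i) = var i
toPoly (e ⊞ f) = toPoly e ⊕ toPoly f
toPoly (e ⊠ f) = toPoly e ⊗ toPoly f

evalPoly-toPoly : ∀ {n} (e : Expr (Fin n)) k → evalPoly (toPoly e) k ≡ ⟦ e ⟧ (ι ∘ lookup k)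
evalPoly-toPoly (con q) k = refl
evalPoly-toPoly (var i) k = refl
evalPoly-toPoly (e ⊞ f) k = cong₂ ℚ._+_ (evalPoly-toPoly e k) (evalPoly-toPoly f k)
evalPoly-toPoly (e ⊠ f) k = cong₂ ℚ._*_ (evalPoly-toPoly e k) (evalPoly-toPoly f k)

WeaklyIncreasing⇒Linked : ∀ {n} {k : Vec ℤ n} → WeaklyIncreasing k → Linked ℤ._≤_ k
WeaklyIncreasing⇒Linked {k = []}        _  = []
WeaklyIncreasing⇒Linked {k = _ ∷ []}    _  = [-]
WeaklyIncreasing⇒Linked {k = _ ∷ _ ∷ _} wi = wi zero (suc zero) z≤n ∷ WeaklyIncreasing⇒Linked λ j l j≤l → wi (suc j) (suc l) (s≤s j≤l)

lookup⇒Triple : ∀ {n} (k : Vec ℤ n) {j j₁ j₂ : Fin n} → toℕ j₁ ≡ suc (toℕ j) → toℕ j₂ ≡ suc (toℕ j₁) →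
                lookup k j ≡ lookup k j₁ → lookup k j₁ ≡ lookup k j₂ → Triple k
lookup⇒Triple (x ∷ k)         {suc j} {suc j₁} {suc j₂} p q eq eq′ =
  there (lookup⇒Triple k (ℕP.suc-injective p) (ℕP.suc-injective q) eq eq′)
lookup⇒Triple (_ ∷ _ ∷ _ ∷ _) {zero} {suc zero} {suc (suc zero)} refl refl refl refl = here

theorem3p7 : (n : ℕ) → 1 ≤ n →
    ((k : Vec ℤ n) → WeaklyIncreasing k →
    (α : ℕ) → Count n (MonotoneTriangle n k) α →
    (ω : List Pt → ℕ) → (∀ S → S ∈ QessList n → Count n (OmegaSet n k S) (ω S)) →
    + α ≡ QessSum n ω)
    × (Σ (Poly n) λ P → (k : Vec ℤ n) → WeaklyIncreasing k →
    (α : ℕ) → Count n (MonotoneTriangle n k) α → evalPoly P k ≡ (+ α) / 1)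
    × ((k : Vec ℤ n) → WeaklyIncreasing k →
    (∃ λ (j : Fin n) → ∃ λ (j₁ : Fin n) → ∃ λ (j₂ : Fin n) →
    (toℕ j₁ ≡ suc (toℕ j)) × (toℕ j₂ ≡ suc (toℕ j₁))
    × (lookup k j ≡ lookup k j₁) × (lookup k j₁ ≡ lookup k j₂)) →
    Count n (MonotoneTriangle n k) 0)
theorem3p7 n _ =
  (λ k _ α cα ω cω → inclusion-exclusion n k cα cω) ,
  (let e , eq = α#-polynomial n in toPoly e , λ k wi α cα →
    let inc = WeaklyIncreasing⇒Linked wi in
    trans (evalPoly-toPoly e k) (trans (sym (eq k inc)) (cong (λ m → ι (+ m)) (Count-unique n (α#-Count n inc) cα)))) ,
  (λ k wi (_ , _ , _ , p , q , eq , eq′) →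
    subst (Count n (MonotoneTriangle n k)) (ℤP.+-injective (α#-triple k (lookup⇒Triple k p q eq eq′)))
      (α#-Count n (WeaklyIncreasing⇒Linked wi)))
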